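{- Let $R$ be a commutative ring such that not every positive integer is invertible in $R$ (i.e. $R$ does not contain $\mathbb Q$), and let $r_0\geq 1$ be the smallest positive integer that is not invertible in $R$. Let $n\geq r_0$. In $R[x_1,\ldots,x_n]$ let $e_k=\sum_{1\le i_1<\dots<i_k\le n}x_{i_1}\cdots x_{i_k}$ for $1\le k\le n$ and $p_k=\sum_{i=1}^n x_i^k$ for $k\ge1$. Then $$R(e_1,\ldots,e_n)=R(p_1,p_2,\ldots,p_{2n+1-r_0}).$$
   Context: For a commutative ring $R$ and polynomials $f_i\in R[x_1,\ldots,x_n]$ ($i\in I$), $R(f_i\mid i\in I)$ denotes the total ring of fractions $S^{ -1}R[f_i\mid i\in I]$ of the subring $R[f_i\mid i\in I]\subseteq R[x_1,\ldots,x_n]$, where $S$ is the multiplicative set of non-zero-divisors of $R[f_i\mid i\in I]$; both sides are regarded inside the total ring of fractions of $R[x_1,\ldots,x_n]$. -}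

module Defs where

open import Level using (Level; _⊔_) renaming (suc to lsuc)
open import Algebra.Bundles using (CommutativeRing)
open import Data.Nat using (ℕ; zero; suc)
open import Data.Fin using (Fin; zero; suc; toℕ)
open import Data.List.Base using (List; []; _∷_; map; _++_; foldr; allFin)
open import Data.Product using (Σ; ∃; _×_; _,_)
open import Data.Unit.Polymorphic using (⊤)

record RawPolyRing (c ℓ : Level) : Set (lsuc (c ⊔ ℓ)) where
  infix 4 _≈_
  field
    Carrier : Set c
    _≈_     : Carrier → Carrier → Set ℓ
    0#      : Carrier
    1#      : Carrier
    _+_     : Carrier → Carrier → Carrier
    _*_     : Carrier → Carrier → Carrier
    -_      : Carrier → Carrier

-- Univariate polynomials over A as coefficient lists (constant term first),
-- with equality "coefficientwise, up to trailing zero coefficients".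
module ListPoly {c ℓ} (A : RawPolyRing c ℓ) where
  open RawPolyRing A

  _≈L_ : List Carrier → List Carrier → Set ℓ
  []       ≈L []       = ⊤
  []       ≈L (b ∷ bs) = (b ≈ 0#) × ([] ≈L bs)
  (a ∷ as) ≈L []       = (a ≈ 0#) × (as ≈L [])
  (a ∷ as) ≈L (b ∷ bs) = (a ≈ b) × (as ≈L bs)

  addL : List Carrier → List Carrier → List Carrier
  addL []       bs       = bs
  addL (a ∷ as) []       = a ∷ as
  addL (a ∷ as) (b ∷ bs) = (a + b) ∷ addL as bs

  negL : List Carrier → List Carrier
  negL = map -_

  mulL : List Carrier → List Carrier → List Carrier
  mulL []       q = []
  mulL (a ∷ as) q = addL (map (a *_) q) (0# ∷ mulL as q)

  listRing : RawPolyRing c ℓ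
  listRing = record
    { Carrier = List Carrier
    ; _≈_ = _≈L_
    ; 0# = []
    ; 1# = 1# ∷ []
    ; _+_ = addL
    ; _*_ = mulL
    ; -_ = negL
    }

module PolyDefs {c ℓ} (R : CommutativeRing c ℓ) where
  private module R = CommutativeRing R

  baseRing : RawPolyRing c ℓ
  baseRing = record
    { Carrier = R.Carrier ; _≈_ = R._≈_ ; 0# = R.0# ; 1# = R.1#
    ; _+_ = R._+_ ; _*_ = R._*_ ; -_ = R.-_ }

  PolyRing : ℕ → RawPolyRing c ℓ
  PolyRing zero    = baseRing
  PolyRing (suc n) = ListPoly.listRing (PolyRing n)

  Poly : ℕ → Set c
  Poly n = RawPolyRing.Carrier (PolyRing n)

  constP : ∀ n → R.Carrier → Poly n
  constP zero    a = a
  constP (suc n) a = constP n a ∷ []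

  var : ∀ n → Fin n → Poly n
  var (suc n) zero    = RawPolyRing.0# (PolyRing n) ∷ RawPolyRing.1# (PolyRing n) ∷ []
  var (suc n) (suc i) = var n i ∷ []

  natR : ℕ → R.Carrier
  natR zero    = R.0#
  natR (suc k) = R.1# R.+ natR k

  Invertible : R.Carrier → Set (c ⊔ ℓ)
  Invertible a = ∃ λ b → (a R.* b) R.≈ R.1#

  combinations : ∀ {a} {A : Set a} → ℕ → List A → List (List A)
  combinations zero    xs       = [] ∷ []
  combinations (suc k) []       = []
  combinations (suc k) (x ∷ xs) = map (x ∷_) (combinations k xs) ++ combinations (suc k) xs

  data Expr (m : ℕ) : Set c where
    cst : R.Carrier → Expr m
    gen : Fin m → Expr m
    add : Expr m → Expr m → Expr m
    mul : Expr m → Expr m → Expr m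
    neg : Expr m → Expr m

  module _ (n : ℕ) where
    open RawPolyRing (PolyRing n)

    sumP : List Carrier → Carrier
    sumP = foldr _+_ 0#

    prodP : List Carrier → Carrier
    prodP = foldr _*_ 1#

    powP : Carrier → ℕ → Carrier
    powP f zero    = 1#
    powP f (suc k) = f * powP f k

    vars : List Carrier
    vars = map (var n) (allFin n)

    elemSym : ℕ → Carrier
    elemSym k = sumP (map prodP (combinations k vars))

    powerSum : ℕ → Carrier
    powerSum k = sumP (map (λ x → powP x k) vars)

    eval : ∀ {m} → (Fin m → Carrier) → Expr m → Carrier
    eval g (cst a)   = constP n a
    eval g (gen i)   = g i
    eval g (add e f) = eval g e + eval g f
    eval g (mul e f) = eval g e * eval g f
    eval g (neg e)   = - eval g e

    InSub : ∀ {m} → (Fin m → Carrier) → Carrier → Set (c ⊔ ℓ)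
    InSub g h = ∃ λ (E : Expr _) → eval g E ≈ h

    NonZeroDivSub : ∀ {m} → (Fin m → Carrier) → Carrier → Set (c ⊔ ℓ)
    NonZeroDivSub g s = InSub g s × (∀ a → InSub g a → (a * s) ≈ 0# → a ≈ 0#)

    -- R(f) ⊆ R(h) inside the total ring of fractions of R[x_1,...,x_n]:
    -- every fraction a/s (a, s ∈ R[f], s a non-zero-divisor of R[f]) equals some
    -- fraction b/t (b, t ∈ R[h], t a non-zero-divisor of R[h]), i.e. a t = b s.
    FracSub : ∀ {m m'} → (Fin m → Carrier) → (Fin m' → Carrier) → Set (c ⊔ ℓ)
    FracSub f h = ∀ a s → InSub f a → NonZeroDivSub f s →
                  ∃ λ b → ∃ λ t → InSub h b × NonZeroDivSub h t × ((a * t) ≈ (b * s))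

    SameFrac : ∀ {m m'} → (Fin m → Carrier) → (Fin m' → Carrier) → Set (c ⊔ ℓ)
    SameFrac f h = FracSub f h × FracSub h f

    eGens : Fin n → Carrier
    eGens i = elemSym (suc (toℕ i))

    pGens : (m : ℕ) → Fin m → Carrier
    pGens m i = powerSum (suc (toℕ i))

{-# OPTIONS --safe #-}

-- With a_k = (-1)^k e_k, Newton's identities read k a_k + Σ_{t<k} p_{t+1} a_{k-1-t} = 0, where a_k = 0 for k > n.
-- For k < r₀ the integer k is invertible, so a_k is a polynomial in p_1, ..., p_k. The N = n + 1 - r₀ identities
-- of index n + 1, ..., 2n + 1 - r₀ form a linear system with Hankel matrix (p_{i+j+1}) for the remaining
-- a_n, ..., a_{r₀}, which is solved by elimination over the fractions of R[p_1, p_2, ...] with regular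
-- denominators. All pivots are regular: each has, in the first variable, a coefficient that is a product of
-- pivots of a smaller Hankel matrix of power sums in one variable less. By McCoy's theorem a non-zero-divisor of
-- a subring containing R is regular in R[x_1, ..., x_n], so denominators can be moved between the two subrings.
module Submission where

open import Defs
open import Level using (Level; _⊔_)
open import Algebra.Bundles using (CommutativeRing)
open import Algebra.Structures using (IsCommutativeRing)
open import Algebra.Morphism.Structures using (module RingMorphisms)
import Algebra.Morphism.Construct.Composition as Composition
import Algebra.Morphism.Construct.Identity as Identity
import Algebra.Properties.CommutativeSemigroup as CommutativeSemigroupProperties
import Algebra.Properties.Ring as RingProperties
import Algebra.Properties.Semiring.Exp as Exp
import Algebra.Properties.Semiring.Mult as Mult
import Algebra.Solver.Ring.NaturalCoefficients.Default as Solver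
open import Data.Nat as ℕ using (ℕ; zero; suc; _≤_; _<_; _∸_; z≤n; s≤s)
import Data.Nat.Properties as ℕ
open import Data.Nat.Solver using (module +-*-Solver)
open import Data.Fin using (Fin; zero; suc; toℕ; fromℕ<)
open import Data.Fin.Properties using (toℕ-fromℕ<; toℕ<n)
open import Data.List.Base using (List; []; _∷_; map; foldr; _++_; concat; length; allFin)
open import Data.List.Properties using (++-identityʳ; map-++; map-cong; map-tabulate; length-map; length-tabulate)
open import Data.List.Relation.Unary.All as All using (All; []; _∷_)
open import Data.List.Relation.Unary.All.Properties using (concat⁺; concat⁻)
open import Data.Product using (∃; _×_; _,_; proj₁; proj₂)
open import Data.Sum using (inj₁; inj₂)
open import Data.Unit.Polymorphic using (⊤; tt)
open import Function using (_∘_; id)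
open import Relation.Binary.Bundles using (Setoid)
open import Relation.Binary.Structures using (IsEquivalence)
import Relation.Binary.PropositionalEquality as ≡
open ≡ using (_≡_)
import Relation.Binary.Reasoning.Setoid as SetoidReasoning
open import Relation.Nullary using (¬_; yes; no)

-- Finite sums in a commutative ring.

module CommutativeRingProperties {c ℓ} (C : CommutativeRing c ℓ) where
  open CommutativeRing C hiding (zero)
  open Exp semiring using (_^_)
  open Mult semiring using () renaming (_×_ to _⋆_)
  open Solver commutativeSemiring using (solve; _:+_; _:*_; _:=_)
  open SetoidReasoning setoid

  Σ< : ℕ → (ℕ → Carrier) → Carrier
  Σ< zero    f = 0#
  Σ< (suc k) f = f 0 + Σ< k (f ∘ suc)

  Σ<-cong : ∀ k {f g} → (∀ i → i < k → f i ≈ g i) → Σ< k f ≈ Σ< k g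
  Σ<-cong zero    eq = refl
  Σ<-cong (suc k) eq = +-cong (eq 0 (s≤s z≤n)) (Σ<-cong k λ i i<k → eq (suc i) (s≤s i<k))

  Σ<-zero : ∀ k → Σ< k (λ _ → 0#) ≈ 0#
  Σ<-zero zero    = refl
  Σ<-zero (suc k) = trans (+-identityˡ _) (Σ<-zero k)

  Σ<-+ : ∀ k f g → Σ< k (λ i → f i + g i) ≈ Σ< k f + Σ< k g
  Σ<-+ zero    f g = sym (+-identityˡ 0#)
  Σ<-+ (suc k) f g = begin
    (f 0 + g 0) + Σ< k (λ i → f (suc i) + g (suc i)) ≈⟨ +-congˡ (Σ<-+ k (f ∘ suc) (g ∘ suc)) ⟩
    (f 0 + g 0) + (Σ< k (f ∘ suc) + Σ< k (g ∘ suc))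
      ≈⟨ solve 4 (λ a b x y → (a :+ b) :+ (x :+ y) := (a :+ x) :+ (b :+ y)) refl _ _ _ _ ⟩
    Σ< (suc k) f + Σ< (suc k) g ∎

  Σ<-*ˡ : ∀ k a f → Σ< k (λ i → a * f i) ≈ a * Σ< k f
  Σ<-*ˡ zero    a f = sym (zeroʳ a)
  Σ<-*ˡ (suc k) a f = trans (+-congˡ (Σ<-*ˡ k a (f ∘ suc))) (sym (distribˡ a _ _))

  Σ<-last : ∀ k f → Σ< (suc k) f ≈ Σ< k f + f k
  Σ<-last zero    f = +-comm (f 0) 0#
  Σ<-last (suc k) f = trans (+-congˡ (Σ<-last k (f ∘ suc))) (sym (+-assoc _ _ _))

  Σ<-split : ∀ k l f → Σ< (k ℕ.+ l) f ≈ Σ< k f + Σ< l (f ∘ (k ℕ.+_))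
  Σ<-split zero    l f = sym (+-identityˡ _)
  Σ<-split (suc k) l f = trans (+-congˡ (Σ<-split k l (f ∘ suc))) (sym (+-assoc _ _ _))

  -- Newton's identities

  powerSumOf : List Carrier → ℕ → Carrier
  powerSumOf xs k = foldr _+_ 0# (map (_^ k) xs)

  -- Coefficient of tᵏ in ∏ (1 - x t), that is (-1)ᵏ eₖ.
  χ : List Carrier → ℕ → Carrier
  χ xs       zero    = 1#
  χ []       (suc k) = 0#
  χ (x ∷ xs) (suc k) = χ xs (suc k) + - x * χ xs k

  -- The coefficient of T^k in y T / (1 - y T) times the power series with coefficients a, in Horner
  -- form to suit induction on k.
  conv : Carrier → ℕ → (ℕ → Carrier) → Carrier
  conv y zero    a = 0#
  conv y (suc k) a = y * (a k + conv y k a)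

  convs : List Carrier → ℕ → (ℕ → Carrier) → Carrier
  convs ys k a = foldr _+_ 0# (map (λ y → conv y k a) ys)

  -- Passing from `xs` to `x ∷ xs` multiplies the generating series of `χ` by 1 - x T, which
  -- commutes with multiplication by y T / (1 - y T).
  conv-χ-∷ : ∀ y x xs k → conv y (suc k) (χ (x ∷ xs)) ≈ conv y (suc k) (χ xs) + - x * conv y k (χ xs)
  conv-χ-∷ y x xs zero    = sym (trans (+-congˡ (zeroʳ _)) (+-identityʳ _))
  conv-χ-∷ y x xs (suc k) = begin
    y * ((χ xs (suc k) + - x * χ xs k) + conv y (suc k) (χ (x ∷ xs)))
      ≈⟨ *-congˡ (+-congˡ (conv-χ-∷ y x xs k)) ⟩
    y * ((χ xs (suc k) + - x * χ xs k) + (conv y (suc k) (χ xs) + - x * conv y k (χ xs)))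
      ≈⟨ solve 6 (λ y a m b t s → y :* ((a :+ m :* b) :+ (t :+ m :* s))
                                := y :* (a :+ t) :+ m :* (y :* (b :+ s))) refl y _ (- x) _ _ _ ⟩
    y * (χ xs (suc k) + conv y (suc k) (χ xs)) + - x * (y * (χ xs k + conv y k (χ xs))) ∎

  -- The new factor 1 - x T cancels the denominator of x T / (1 - x T).
  conv-χ-head : ∀ x xs k → conv x (suc k) (χ (x ∷ xs)) ≈ x * χ xs k
  conv-χ-head x xs k = begin
    conv x (suc k) (χ (x ∷ xs)) ≈⟨ conv-χ-∷ x x xs k ⟩
    x * (χ xs k + conv x k (χ xs)) + - x * conv x k (χ xs)
      ≈⟨ solve 4 (λ x m a t → x :* (a :+ t) :+ m :* t := x :* a :+ (x :+ m) :* t) refl x (- x) _ _ ⟩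
    x * χ xs k + (x + - x) * conv x k (χ xs) ≈⟨ +-congˡ (trans (*-congʳ (-‿inverseʳ x)) (zeroˡ _)) ⟩
    x * χ xs k + 0# ≈⟨ +-identityʳ _ ⟩
    x * χ xs k ∎

  convs-χ-∷ : ∀ ys x xs k →
    convs ys (suc k) (χ (x ∷ xs)) ≈ convs ys (suc k) (χ xs) + - x * convs ys k (χ xs)
  convs-χ-∷ []       x xs k = sym (trans (+-congˡ (zeroʳ _)) (+-identityʳ _))
  convs-χ-∷ (y ∷ ys) x xs k = begin
    conv y (suc k) (χ (x ∷ xs)) + convs ys (suc k) (χ (x ∷ xs))
      ≈⟨ +-cong (conv-χ-∷ y x xs k) (convs-χ-∷ ys x xs k) ⟩
    (conv y (suc k) (χ xs) + - x * conv y k (χ xs)) + (convs ys (suc k) (χ xs) + - x * convs ys k (χ xs))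
      ≈⟨ solve 5 (λ m a b d e → (a :+ m :* b) :+ (d :+ m :* e) := (a :+ d) :+ m :* (b :+ e))
                 refl (- x) _ _ _ _ ⟩
    (conv y (suc k) (χ xs) + convs ys (suc k) (χ xs)) + - x * (conv y k (χ xs) + convs ys k (χ xs)) ∎

  -- The logarithmic derivative of E = ∏ (1 - x T), in the form T E' + Σ (x T / (1 - x T)) E = 0,
  -- proved by adjoining one factor at a time.
  newton-convs : ∀ xs k → (k ⋆ 1#) * χ xs k + convs xs k (χ xs) ≈ 0#
  newton-convs []       zero    = trans (+-identityʳ _) (zeroˡ _)
  newton-convs []       (suc k) = trans (+-identityʳ _) (zeroʳ _)
  newton-convs (x ∷ xs) zero    = trans (+-congˡ (+-identityˡ _)) (newton-convs xs zero)
  newton-convs (x ∷ xs) (suc k) = begin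
    μ * (χ xs (suc k) + - x * χ xs k) + (conv x (suc k) (χ (x ∷ xs)) + convs xs (suc k) (χ (x ∷ xs)))
      ≈⟨ +-congˡ (+-cong (conv-χ-head x xs k) (convs-χ-∷ xs x xs k)) ⟩
    μ * (χ xs (suc k) + - x * χ xs k) + (x * χ xs k + (convs xs (suc k) (χ xs) + - x * convs xs k (χ xs)))
      -- As `μ` is `1# + ν`, one copy of - x χ_k splits off and cancels the head term x χ_k; what
      -- remains is the identity of index k + 1 plus - x times that of index k.
      ≈⟨ solve 8 (λ o ν x m a b t s →
           (o :+ ν) :* (a :+ m :* b) :+ (x :* b :+ (t :+ m :* s))
           := ((o :+ ν) :* a :+ t) :+ (m :* (ν :* b :+ s) :+ (m :* o :+ x) :* b))
           refl 1# ν x (- x) (χ xs (suc k)) (χ xs k) _ _ ⟩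
    (μ * χ xs (suc k) + convs xs (suc k) (χ xs))
      + (- x * (ν * χ xs k + convs xs k (χ xs)) + (- x * 1# + x) * χ xs k)
      ≈⟨ +-cong (newton-convs xs (suc k))
           (+-cong (trans (*-congˡ (newton-convs xs k)) (zeroʳ _))
                   (trans (*-congʳ (trans (+-congʳ (*-identityʳ _)) (-‿inverseˡ x))) (zeroˡ _))) ⟩
    0# + (0# + 0#) ≈⟨ trans (+-identityˡ _) (+-identityˡ _) ⟩
    0# ∎
    where
      ν = k ⋆ 1#
      μ = 1# + ν

  conv-Σ< : ∀ y k a → conv y k a ≈ Σ< k (λ t → y ^ suc t * a (k ∸ suc t))
  conv-Σ< y zero    a = refl
  conv-Σ< y (suc k) a = begin
    y * (a k + conv y k a) ≈⟨ distribˡ y _ _ ⟩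
    y * a k + y * conv y k a
      ≈⟨ +-cong (*-congʳ (sym (*-identityʳ y))) (*-congˡ (conv-Σ< y k a)) ⟩
    (y * 1#) * a k + y * Σ< k (λ t → y ^ suc t * a (k ∸ suc t))
      ≈⟨ +-congˡ (Σ<-*ˡ k y _) ⟨
    (y * 1#) * a k + Σ< k (λ t → y * (y ^ suc t * a (k ∸ suc t)))
      ≈⟨ +-congˡ (Σ<-cong k λ t _ → sym (*-assoc y _ _)) ⟩
    Σ< (suc k) (λ t → y ^ suc t * a (suc k ∸ suc t)) ∎

  convs-Σ< : ∀ ys k a → convs ys k a ≈ Σ< k (λ t → powerSumOf ys (suc t) * a (k ∸ suc t))
  convs-Σ< []       k a = sym (trans (Σ<-cong k λ t _ → zeroˡ _) (Σ<-zero k))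
  convs-Σ< (y ∷ ys) k a = begin
    conv y k a + convs ys k a ≈⟨ +-cong (conv-Σ< y k a) (convs-Σ< ys k a) ⟩
    Σ< k (λ t → y ^ suc t * a (k ∸ suc t)) + Σ< k (λ t → powerSumOf ys (suc t) * a (k ∸ suc t))
      ≈⟨ Σ<-+ k _ _ ⟨
    Σ< k (λ t → y ^ suc t * a (k ∸ suc t) + powerSumOf ys (suc t) * a (k ∸ suc t))
      ≈⟨ Σ<-cong k (λ t _ → distribʳ _ _ _) ⟨
    Σ< k (λ t → powerSumOf (y ∷ ys) (suc t) * a (k ∸ suc t)) ∎

  newton : ∀ xs k →
    (k ⋆ 1#) * χ xs k + Σ< k (λ t → powerSumOf xs (suc t) * χ xs (k ∸ suc t)) ≈ 0#
  newton xs k = trans (+-congˡ (sym (convs-Σ< xs k (χ xs)))) (newton-convs xs k)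

  -- Gaussian elimination, starting from the last row and column

  Matrix : Set c
  Matrix = ℕ → ℕ → Carrier

  Regular : Carrier → Set (c ⊔ ℓ)
  Regular t = ∀ a → a * t ≈ 0# → a ≈ 0#

  regular-1 : Regular 1#
  regular-1 a a1≈0 = trans (sym (*-identityʳ a)) a1≈0

  regular-* : ∀ {s t} → Regular s → Regular t → Regular (s * t)
  regular-* rs rt a ast≈0 = rs a (rt _ (trans (*-assoc a _ _) ast≈0))

  -- Fraction-free: row i is multiplied by the pivot where Gaussian elimination would divide by it,
  -- so the entries stay in the ring.
  eliminate : ℕ → Matrix → Matrix
  eliminate N H i j = H N N * H i j + - H i N * H N j

  RegularPivots : ℕ → Matrix → Set (c ⊔ ℓ)
  RegularPivots zero    H = ⊤
  RegularPivots (suc N) H = Regular (H N N) × RegularPivots N (eliminate N H)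

  lastPivot : ℕ → Matrix → Carrier
  lastPivot zero    H = H 0 0
  lastPivot (suc N) H = lastPivot N (eliminate (suc N) H)

  -- The coefficient of H 0 0 in lastPivot N H, which is an affine function of that entry.
  cornerCofactor : ℕ → Matrix → Carrier
  cornerCofactor zero    H = 1#
  cornerCofactor (suc N) H = cornerCofactor N (eliminate (suc N) H) * H (suc N) (suc N)

  lower : Matrix → Matrix
  lower H i j = H (suc i) (suc j)

  -- The factors are the pivots of `lower H`, because `lower (eliminate (suc N) H)` is
  -- `eliminate N (lower H)` by definition.
  cornerCofactor-regular : ∀ N H → RegularPivots N (lower H) → Regular (cornerCofactor N H)
  cornerCofactor-regular zero    H _           = regular-1
  cornerCofactor-regular (suc N) H (reg , piv) =
    regular-* (cornerCofactor-regular N (eliminate (suc N) H) piv) reg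

  -- Elimination from the bottom right meets the pivots of `lower H` first, and only the corner is
  -- left.
  regularPivots-suc : ∀ N H → Regular (lastPivot N H) → RegularPivots N (lower H) → RegularPivots (suc N) H
  regularPivots-suc zero    H last _           = last , tt
  regularPivots-suc (suc N) H last (reg , piv) = reg , regularPivots-suc N (eliminate (suc N) H) last piv

  eliminate-Σ< : ∀ N a m (h d u : ℕ → Carrier) →
    Σ< N (λ j → (a * h j + m * d j) * u j) ≈ a * Σ< N (λ j → h j * u j) + m * Σ< N (λ j → d j * u j)
  eliminate-Σ< N a m h d u = begin
    Σ< N (λ j → (a * h j + m * d j) * u j)
      ≈⟨ Σ<-cong N (λ j _ → solve 5 (λ a m h d u → (a :* h :+ m :* d) :* u := a :* (h :* u) :+ m :* (d :* u))
                                    refl a m (h j) (d j) (u j)) ⟩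
    Σ< N (λ j → a * (h j * u j) + m * (d j * u j)) ≈⟨ Σ<-+ N _ _ ⟩
    Σ< N (λ j → a * (h j * u j)) + Σ< N (λ j → m * (d j * u j)) ≈⟨ +-cong (Σ<-*ˡ N a _) (Σ<-*ˡ N m _) ⟩
    a * Σ< N (λ j → h j * u j) + m * Σ< N (λ j → d j * u j) ∎

  row-eliminate : ∀ N H (u : ℕ → Carrier) i →
    Σ< N (λ j → eliminate N H i j * u j)
      ≈ H N N * Σ< (suc N) (λ j → H i j * u j) + - H i N * Σ< (suc N) (λ j → H N j * u j)
  row-eliminate N H u i = begin
    Σ< N (λ j → eliminate N H i j * u j) ≈⟨ eliminate-Σ< N (H N N) (- H i N) (H i) (H N) u ⟩
    H N N * S + - H i N * T
      -- The zero inserted here is the contribution of column N, which cancels between the two rows.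
      ≈⟨ trans (+-congˡ (trans (*-congʳ (-‿inverseʳ (H i N))) (zeroˡ _))) (+-identityʳ _) ⟨
    (H N N * S + - H i N * T) + (H i N + - H i N) * (H N N * u N)
      ≈⟨ solve 6 (λ a h m s t v → (a :* s :+ m :* t) :+ (h :+ m) :* (a :* v)
                                  := a :* (s :+ h :* v) :+ m :* (t :+ a :* v))
                 refl (H N N) (H i N) (- H i N) S T (u N) ⟩
    H N N * (S + H i N * u N) + - H i N * (T + H N N * u N)
      ≈⟨ +-cong (*-congˡ (Σ<-last N _)) (*-congˡ (Σ<-last N _)) ⟨
    H N N * Σ< (suc N) (λ j → H i j * u j) + - H i N * Σ< (suc N) (λ j → H N j * u j) ∎
    where
      S = Σ< N (λ j → H i j * u j)
      T = Σ< N (λ j → H N j * u j)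

  -- Subrings, and division by regular elements.

  record IsSubring {p} (P : Carrier → Set p) : Set (c ⊔ ℓ ⊔ p) where
    field
      resp  : ∀ {x y} → x ≈ y → P x → P y
      P-1   : P 1#
      P-+   : ∀ {x y} → P x → P y → P (x + y)
      P-*   : ∀ {x y} → P x → P y → P (x * y)
      P-neg : ∀ {x} → P x → P (- x)

    P-0 : P 0#
    P-0 = resp (-‿inverseʳ 1#) (P-+ P-1 (P-neg P-1))

    P-⋆1 : ∀ k → P (k ⋆ 1#)
    P-⋆1 zero    = P-0
    P-⋆1 (suc k) = P-+ P-1 (P-⋆1 k)

    P-^ : ∀ {x} → P x → ∀ k → P (x ^ k)
    P-^ Px zero    = P-1
    P-^ Px (suc k) = P-* Px (P-^ Px k)

    P-Σ< : ∀ k f → (∀ i → i < k → P (f i)) → P (Σ< k f)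
    P-Σ< zero    f Pf = P-0
    P-Σ< (suc k) f Pf = P-+ (Pf 0 (s≤s z≤n)) (P-Σ< k (f ∘ suc) λ i i<k → Pf (suc i) (s≤s i<k))

    P-cancelˡ : ∀ {x y} → P x → P (x + y) → P y
    P-cancelˡ {x} {y} Px Pxy = resp eq (P-+ (P-neg Px) Pxy)
      where
      eq : - x + (x + y) ≈ y
      eq = trans (sym (+-assoc _ _ _)) (trans (+-congʳ (-‿inverseˡ x)) (+-identityˡ y))

    P-cancelʳ : ∀ {x y} → P y → P (x + y) → P x
    P-cancelʳ Py Pxy = P-cancelˡ Py (resp (+-comm _ _) Pxy)

  -- Stands in for a ring of fractions: quotients are taken only where they exist in the ambient
  -- ring, and regularity makes them unique.
  record IsDivisionClosed {p} (P : Carrier → Set p) : Set (c ⊔ ℓ ⊔ p) where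
    field
      isSubring : IsSubring P
      P-÷       : ∀ {x y} → P x → Regular x → P (x * y) → P y
    open IsSubring isSubring public

    -- The solution u is given in the ring and only its membership in P is at stake. Elimination
    -- keeps entries and row values in P, and each `u j` is recovered by division by its pivot.
    solve-linear : ∀ N H (u : ℕ → Carrier) → RegularPivots N H →
      (∀ i j → i < N → j < N → P (H i j)) →
      (∀ i → i < N → P (Σ< N (λ j → H i j * u j))) →
      ∀ j → j < N → P (u j)
    solve-linear (suc N) H u (reg , piv) PH Prow = result
      where
      N<1+N : N < suc N
      N<1+N = ℕ.n<1+n N

      <-up : ∀ {i} → i < N → i < suc N
      <-up = ℕ.m<n⇒m<1+n

      P-below : ∀ j → j < N → P (u j)
      P-below = solve-linear N (eliminate N H) u piv
        (λ i j i<N j<N → P-+ (P-* (PH N N N<1+N N<1+N) (PH i j (<-up i<N) (<-up j<N)))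
                             (P-* (P-neg (PH i N (<-up i<N) N<1+N)) (PH N j N<1+N (<-up j<N))))
        (λ i i<N → resp (sym (row-eliminate N H u i))
          (P-+ (P-* (PH N N N<1+N N<1+N) (Prow i (<-up i<N)))
               (P-* (P-neg (PH i N (<-up i<N) N<1+N)) (Prow N N<1+N))))

      -- Once the earlier unknowns are subtracted, row N leaves the pivot times `u N`.
      P-last : P (u N)
      P-last = P-÷ (PH N N N<1+N N<1+N) reg (P-cancelˡ
        (P-Σ< N _ λ j j<N → P-* (PH N j N<1+N (<-up j<N)) (P-below j j<N))
        (resp (Σ<-last N _) (Prow N N<1+N)))

      result : ∀ j → j < suc N → P (u j)
      result j (s≤s j≤N) with ℕ.m≤n⇒m<n∨m≡n j≤N
      ... | inj₁ j<N    = P-below j j<N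
      ... | inj₂ ≡.refl = P-last

-- Computation in D modulo Y X, where Y = X Z. As Y² is a multiple of Y X, Y behaves like the dual number ε.
module DualNumbers {c ℓ c′ ℓ′} (C : CommutativeRing c ℓ) (D : CommutativeRing c′ ℓ′)
  {ι : CommutativeRing.Carrier C → CommutativeRing.Carrier D}
  (ι-hom : RingMorphisms.IsRingHomomorphism (CommutativeRing.rawRing C) (CommutativeRing.rawRing D) ι)
  (X Z : CommutativeRing.Carrier D) where
  private
    module C = CommutativeRing C
    module CP = CommutativeRingProperties C
    module DP = CommutativeRingProperties D
  open CommutativeRing D hiding (zero)
  open RingMorphisms C.rawRing rawRing using (module IsRingHomomorphism)
  open IsRingHomomorphism ι-hom
  open Solver commutativeSemiring using (solve; _:+_; _:*_; _:=_)
  open RingProperties ring using (-‿distribʳ-*; -‿+-comm)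

  Y : Carrier
  Y = X * Z

  -- Read as f = a + b ε. Keeping Y as a factor of everything beyond a lets a power of X be
  -- cancelled later.
  Lift : Carrier → C.Carrier → C.Carrier → Set (c′ ⊔ ℓ′)
  Lift f a b = ∃ λ q → f ≈ ι a + Y * (ι b + X * q)

  lift-resp : ∀ {f a b a′ b′} → a C.≈ a′ → b C.≈ b′ → Lift f a b → Lift f a′ b′
  lift-resp a≈ b≈ (q , eq) = q , trans eq (+-cong (⟦⟧-cong a≈) (*-congˡ (+-congʳ (⟦⟧-cong b≈))))

  lift-YX : ∀ q → Lift (Y * (X * q)) C.0# C.0#
  lift-YX q = q , sym (trans (+-congʳ 0#-homo) (trans (+-identityˡ _)
    (*-congˡ (trans (+-congʳ 0#-homo) (+-identityˡ _)))))

  lift-Y : Lift Y C.0# C.1#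
  lift-Y = 0# , sym (trans (+-congʳ 0#-homo) (trans (+-identityˡ _)
    (trans (*-congˡ (trans (+-cong 1#-homo (zeroʳ X)) (+-identityʳ 1#))) (*-identityʳ Y))))

  lift-const : ∀ a → Lift (ι a) a C.0#
  lift-const a = 0# , sym (trans (+-congˡ (trans (*-congˡ (trans (+-cong 0#-homo (zeroʳ X)) (+-identityʳ 0#)))
    (zeroʳ Y))) (+-identityʳ _))

  lift-+ : ∀ {f g a b a′ b′} → Lift f a b → Lift g a′ b′ → Lift (f + g) (a C.+ a′) (b C.+ b′)
  lift-+ {a = a} {b} {a′} {b′} (q , f≈) (q′ , g≈) = q + q′ , trans (+-cong f≈ g≈) (trans
    (solve 8 (λ a b a′ b′ q q′ x y → (a :+ y :* (b :+ x :* q)) :+ (a′ :+ y :* (b′ :+ x :* q′))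
                := (a :+ a′) :+ y :* ((b :+ b′) :+ x :* (q :+ q′))) refl _ _ _ _ q q′ X Y)
    (sym (+-cong (+-homo a a′) (*-congˡ (+-congʳ (+-homo b b′))))))

  -- The product of the two Y-parts contains Y * Y = Y * (X * Z) and is absorbed into the multiple
  -- of Y * X; this is the term with the factor z.
  lift-* : ∀ {f g a b a′ b′} → Lift f a b → Lift g a′ b′ →
    Lift (f * g) (a C.* a′) (a C.* b′ C.+ b C.* a′)
  lift-* {a = a} {b} {a′} {b′} (q , f≈) (q′ , g≈) = _ , trans (*-cong f≈ g≈) (trans
    (solve 8 (λ a b a′ b′ q q′ x z →
        (a :+ (x :* z) :* (b :+ x :* q)) :* (a′ :+ (x :* z) :* (b′ :+ x :* q′))
        := a :* a′ :+ (x :* z) :* ((a :* b′ :+ b :* a′)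
             :+ x :* (a :* q′ :+ a′ :* q :+ z :* ((b :+ x :* q) :* (b′ :+ x :* q′)))))
      refl (ι a) (ι b) (ι a′) (ι b′) q q′ X Z)
    (sym (+-cong (*-homo a a′) (*-congˡ (+-congʳ
      (trans (+-homo _ _) (+-cong (*-homo a b′) (*-homo b a′))))))))

  lift-neg : ∀ {f a b} → Lift f a b → Lift (- f) (C.- a) (C.- b)
  lift-neg {a = a} {b} (q , f≈) = - q , trans (-‿cong f≈) (trans (sym (-‿+-comm _ _))
    (+-cong (sym (-‿homo a)) (trans (-‿distribʳ-* Y _) (*-congˡ (trans (sym (-‿+-comm _ _))
      (+-cong (sym (-‿homo b)) (-‿distribʳ-* X q)))))))

  -- Entries away from the corner are constant modulo Y X; only H 0 0 has a Y-part.
  lift-lastPivot : ∀ N {H h b} →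
    (∀ i j → Lift (H i (suc j)) (h i (suc j)) C.0#) →
    (∀ i j → Lift (H (suc i) j) (h (suc i) j) C.0#) →
    Lift (H 0 0) (h 0 0) b →
    Lift (DP.lastPivot N H) (CP.lastPivot N h) (b C.* CP.cornerCofactor N h)
  lift-lastPivot zero    right below corner =
    lift-resp C.refl (C.sym (C.*-identityʳ _)) corner
  lift-lastPivot (suc N) {H} {h} {b} right below corner =
    lift-resp C.refl
      (C.trans (C.*-congʳ (C.*-comm _ b)) (C.trans (C.*-assoc b _ _) (C.*-congˡ (C.*-comm _ _))))
      (lift-lastPivot N
        (λ i j → entry (right i j) (right i N) (below N (suc j)))
        (λ i j → entry (below i j) (right (suc i) N) (below N j))
        (lift-resp C.refl
          (C.trans (C.+-cong (C.+-congˡ (C.zeroˡ _))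
                             (C.trans (C.+-congˡ (C.trans (C.*-congʳ neg0) (C.zeroˡ _)))
                                      (C.trans (C.+-identityʳ _) (C.zeroʳ _))))
                   (C.trans (C.+-identityʳ _) (C.+-identityʳ _)))
          (lift-+ (lift-* (right (suc N) N) corner) (lift-* (lift-neg (right 0 N)) (below N 0)))))
    where
    neg0 : C.- C.0# C.≈ C.0#
    neg0 = RingProperties.-0#≈0# C.ring

    entry : ∀ {f g k a a′ a″} → Lift f a C.0# → Lift g a′ C.0# → Lift k a″ C.0# →
      Lift (H (suc N) (suc N) * f + - g * k)
           (h (suc N) (suc N) C.* a C.+ C.- a′ C.* a″) C.0#
    entry F G K = lift-resp C.refl
      (C.trans (C.+-cong (C.+-cong (C.zeroʳ _) (C.zeroˡ _))
                         (C.+-cong (C.zeroʳ _) (C.trans (C.*-congʳ neg0) (C.zeroˡ _))))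
        (C.trans (C.+-cong (C.+-identityˡ _) (C.+-identityˡ _)) (C.+-identityˡ _)))
      (lift-+ (lift-* (right (suc N) N) F) (lift-* (lift-neg G) K))

private
  variable
    c ℓ : Level

IsPolyRing : RawPolyRing c ℓ → Set (c ⊔ ℓ)
IsPolyRing A = IsCommutativeRing _≈_ _+_ _*_ -_ 0# 1#
  where open RawPolyRing A

toCommutativeRing : (A : RawPolyRing c ℓ) → IsPolyRing A → CommutativeRing c ℓ
toCommutativeRing A isPolyRing = record { isCommutativeRing = isPolyRing }

-- The ring of univariate polynomials as coefficient lists.

module ListPolyProperties {c ℓ} (A : RawPolyRing c ℓ) (isPolyRing : IsPolyRing A) where
  private
    module A = CommutativeRing (toCommutativeRing A isPolyRing)
    module AP = RingProperties A.ring
    module A* = CommutativeSemigroupProperties A.*-commutativeSemigroup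
  open A using (Carrier; 0#; 1#; _≈_)
  open ListPoly A

  -- Lists that differ by trailing zeros count as equal, so the additive laws are checked
  -- coefficientwise, where lengths are invisible.
  coeff : List Carrier → ℕ → Carrier
  coeff []       i       = 0#
  coeff (a ∷ as) zero    = a
  coeff (a ∷ as) (suc i) = coeff as i

  ≈L⇒coeff : ∀ f g → f ≈L g → ∀ i → coeff f i ≈ coeff g i
  ≈L⇒coeff []       []       _         i       = A.refl
  ≈L⇒coeff []       (b ∷ bs) (b≈0 , _) zero    = A.sym b≈0
  ≈L⇒coeff []       (b ∷ bs) (_ , eq)  (suc i) = ≈L⇒coeff [] bs eq i
  ≈L⇒coeff (a ∷ as) []       (a≈0 , _) zero    = a≈0
  ≈L⇒coeff (a ∷ as) []       (_ , eq)  (suc i) = ≈L⇒coeff as [] eq i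
  ≈L⇒coeff (a ∷ as) (b ∷ bs) (a≈b , _) zero    = a≈b
  ≈L⇒coeff (a ∷ as) (b ∷ bs) (_ , eq)  (suc i) = ≈L⇒coeff as bs eq i

  coeff⇒≈L : ∀ f g → (∀ i → coeff f i ≈ coeff g i) → f ≈L g
  coeff⇒≈L []       []       eq = tt
  coeff⇒≈L []       (b ∷ bs) eq = A.sym (eq 0) , coeff⇒≈L [] bs (eq ∘ suc)
  coeff⇒≈L (a ∷ as) []       eq = eq 0 , coeff⇒≈L as [] (eq ∘ suc)
  coeff⇒≈L (a ∷ as) (b ∷ bs) eq = eq 0 , coeff⇒≈L as bs (eq ∘ suc)

  -- A record (rather than _≈L_ itself, which computes) lets Agda infer the two polynomials.
  record _≋_ (f g : List Carrier) : Set ℓ where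
    constructor mk
    field at : ∀ i → coeff f i ≈ coeff g i
  open _≋_

  to : ∀ {f g} → f ≋ g → f ≈L g
  to {f} {g} eq = coeff⇒≈L f g (at eq)

  from : ∀ {f g} → f ≈L g → f ≋ g
  from {f} {g} eq = mk (≈L⇒coeff f g eq)

  ≋-isEquivalence : IsEquivalence _≋_
  ≋-isEquivalence = record
    { refl  = mk λ i → A.refl
    ; sym   = λ eq → mk λ i → A.sym (at eq i)
    ; trans = λ eq₁ eq₂ → mk λ i → A.trans (at eq₁ i) (at eq₂ i)
    }

  ≋-setoid : Setoid c ℓ
  ≋-setoid = record { isEquivalence = ≋-isEquivalence }

  open IsEquivalence ≋-isEquivalence
  open SetoidReasoning ≋-setoid

  scale : Carrier → List Carrier → List Carrier
  scale a = map (a A.*_)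

  coeff-addL : ∀ f g i → coeff (addL f g) i ≈ coeff f i A.+ coeff g i
  coeff-addL []       g        i       = A.sym (A.+-identityˡ _)
  coeff-addL (a ∷ as) []       i       = A.sym (A.+-identityʳ _)
  coeff-addL (a ∷ as) (b ∷ bs) zero    = A.refl
  coeff-addL (a ∷ as) (b ∷ bs) (suc i) = coeff-addL as bs i

  coeff-negL : ∀ f i → coeff (negL f) i ≈ A.- coeff f i
  coeff-negL []       i       = A.sym AP.-0#≈0#
  coeff-negL (a ∷ as) zero    = A.refl
  coeff-negL (a ∷ as) (suc i) = coeff-negL as i

  coeff-scale : ∀ a f i → coeff (scale a f) i ≈ a A.* coeff f i
  coeff-scale a []       i       = A.sym (A.zeroʳ a)
  coeff-scale a (b ∷ bs) zero    = A.refl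
  coeff-scale a (b ∷ bs) (suc i) = coeff-scale a bs i

  ∷-cong : ∀ {a b f g} → a ≈ b → f ≋ g → (a ∷ f) ≋ (b ∷ g)
  ∷-cong a≈b f≋g = mk λ { zero → a≈b ; (suc i) → at f≋g i }

  0∷[]≋[] : (0# ∷ []) ≋ []
  0∷[]≋[] = mk λ { zero → A.refl ; (suc i) → A.refl }

  addL-cong : ∀ {f f′ g g′} → f ≋ f′ → g ≋ g′ → addL f g ≋ addL f′ g′
  addL-cong {f} {f′} {g} {g′} p q = mk λ i → A.trans (coeff-addL f g i)
    (A.trans (A.+-cong (at p i) (at q i)) (A.sym (coeff-addL f′ g′ i)))

  addL-congˡ : ∀ f {g g′} → g ≋ g′ → addL f g ≋ addL f g′
  addL-congˡ f = addL-cong (refl {f})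

  addL-congʳ : ∀ g {f f′} → f ≋ f′ → addL f g ≋ addL f′ g
  addL-congʳ g p = addL-cong p (refl {g})

  addL-comm : ∀ f g → addL f g ≋ addL g f
  addL-comm f g = mk λ i → A.trans (coeff-addL f g i)
    (A.trans (A.+-comm _ _) (A.sym (coeff-addL g f i)))

  addL-assoc : ∀ f g h → addL (addL f g) h ≋ addL f (addL g h)
  addL-assoc f g h = mk λ i →
    A.trans (coeff-addL (addL f g) h i)
    (A.trans (A.+-congʳ (coeff-addL f g i))
    (A.trans (A.+-assoc _ _ _)
    (A.trans (A.+-congˡ (A.sym (coeff-addL g h i))) (A.sym (coeff-addL f (addL g h) i)))))

  addL-identityʳ : ∀ f → addL f [] ≋ f
  addL-identityʳ f = addL-comm f []

  addL-medial : ∀ f g h k → addL (addL f g) (addL h k) ≋ addL (addL f h) (addL g k)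
  addL-medial f g h k = begin
    addL (addL f g) (addL h k) ≈⟨ addL-assoc f g _ ⟩
    addL f (addL g (addL h k)) ≈⟨ addL-congˡ f (addL-assoc g h k) ⟨
    addL f (addL (addL g h) k) ≈⟨ addL-congˡ f (addL-congʳ k (addL-comm g h)) ⟩
    addL f (addL (addL h g) k) ≈⟨ addL-congˡ f (addL-assoc h g k) ⟩
    addL f (addL h (addL g k)) ≈⟨ addL-assoc f h _ ⟨
    addL (addL f h) (addL g k) ∎

  negL-cong : ∀ {f g} → f ≋ g → negL f ≋ negL g
  negL-cong {f} {g} eq = mk λ i → A.trans (coeff-negL f i)
    (A.trans (A.-‿cong (at eq i)) (A.sym (coeff-negL g i)))

  negL-inverseʳ : ∀ f → addL f (negL f) ≋ []
  negL-inverseʳ f = mk λ i → A.trans (coeff-addL f (negL f) i)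
    (A.trans (A.+-congˡ (coeff-negL f i)) (A.-‿inverseʳ _))

  scale-cong : ∀ {a b f g} → a ≈ b → f ≋ g → scale a f ≋ scale b g
  scale-cong {a} {b} {f} {g} a≈b f≋g = mk λ i → A.trans (coeff-scale a f i)
    (A.trans (A.*-cong a≈b (at f≋g i)) (A.sym (coeff-scale b g i)))

  scale-zeroˡ : ∀ f → scale 0# f ≋ []
  scale-zeroˡ f = mk λ i → A.trans (coeff-scale 0# f i) (A.zeroˡ _)

  scale-identityˡ : ∀ f → scale 1# f ≋ f
  scale-identityˡ f = mk λ i → A.trans (coeff-scale 1# f i) (A.*-identityˡ _)

  scale-comm : ∀ a b f → scale a (scale b f) ≋ scale b (scale a f)
  scale-comm a b f = mk λ i →
    A.trans (coeff-scale a (scale b f) i)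
    (A.trans (A.*-congˡ (coeff-scale b f i))
    (A.trans (A*.x∙yz≈y∙xz a b _)
    (A.trans (A.*-congˡ (A.sym (coeff-scale a f i))) (A.sym (coeff-scale b (scale a f) i)))))

  scale-addL : ∀ a f g → scale a (addL f g) ≋ addL (scale a f) (scale a g)
  scale-addL a f g = mk λ i →
    A.trans (coeff-scale a (addL f g) i)
    (A.trans (A.*-congˡ (coeff-addL f g i))
    (A.trans (A.distribˡ a _ _)
    (A.trans (A.+-cong (A.sym (coeff-scale a f i)) (A.sym (coeff-scale a g i)))
    (A.sym (coeff-addL (scale a f) (scale a g) i)))))

  mulL-congˡ : ∀ f {g g′} → g ≋ g′ → mulL f g ≋ mulL f g′
  mulL-congˡ []       eq = refl
  mulL-congˡ (a ∷ as) eq =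
    addL-cong (scale-cong A.refl eq) (∷-cong A.refl (mulL-congˡ as eq))

  mulL-zeroʳ : ∀ f → mulL f [] ≋ []
  mulL-zeroʳ []       = refl
  mulL-zeroʳ (a ∷ as) = trans (∷-cong A.refl (mulL-zeroʳ as)) 0∷[]≋[]

  -- `mulL` recurses on its left factor; the matching recursion on the right factor yields
  -- commutativity.
  mulL-∷ʳ : ∀ f b bs → mulL f (b ∷ bs) ≋ addL (scale b f) (0# ∷ mulL f bs)
  mulL-∷ʳ []       b bs = sym 0∷[]≋[]
  mulL-∷ʳ (a ∷ as) b bs = ∷-cong (A.+-congʳ (A.*-comm a b)) (begin
    addL (scale a bs) (mulL as (b ∷ bs))
      ≈⟨ addL-congˡ (scale a bs) (mulL-∷ʳ as b bs) ⟩
    addL (scale a bs) (addL (scale b as) (0# ∷ mulL as bs))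
      ≈⟨ addL-assoc (scale a bs) (scale b as) _ ⟨
    addL (addL (scale a bs) (scale b as)) (0# ∷ mulL as bs)
      ≈⟨ addL-congʳ (0# ∷ mulL as bs) (addL-comm (scale a bs) (scale b as)) ⟩
    addL (addL (scale b as) (scale a bs)) (0# ∷ mulL as bs)
      ≈⟨ addL-assoc (scale b as) (scale a bs) _ ⟩
    addL (scale b as) (mulL (a ∷ as) bs) ∎)

  mulL-comm : ∀ f g → mulL f g ≋ mulL g f
  mulL-comm f []       = mulL-zeroʳ f
  mulL-comm f (b ∷ bs) = trans (mulL-∷ʳ f b bs) (addL-congˡ (scale b f) (∷-cong A.refl (mulL-comm f bs)))

  -- Congruence in the left factor is moved to the right by commutativity, since equal left factors
  -- may be lists of different lengths.
  mulL-cong : ∀ {f f′ g g′} → f ≋ f′ → g ≋ g′ → mulL f g ≋ mulL f′ g′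
  mulL-cong {f} {f′} {g} {g′} p q = begin
    mulL f g   ≈⟨ mulL-congˡ f q ⟩
    mulL f g′  ≈⟨ mulL-comm f g′ ⟩
    mulL g′ f  ≈⟨ mulL-congˡ g′ p ⟩
    mulL g′ f′ ≈⟨ mulL-comm g′ f′ ⟩
    mulL f′ g′ ∎

  mulL-distribˡ : ∀ f g h → mulL f (addL g h) ≋ addL (mulL f g) (mulL f h)
  mulL-distribˡ []       g h = refl
  mulL-distribˡ (a ∷ as) g h = begin
    addL (scale a (addL g h)) (0# ∷ mulL as (addL g h))
      ≈⟨ addL-cong (scale-addL a g h)
           (∷-cong (A.sym (A.+-identityʳ 0#)) (mulL-distribˡ as g h)) ⟩
    addL (addL (scale a g) (scale a h)) (addL (0# ∷ mulL as g) (0# ∷ mulL as h))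
      ≈⟨ addL-medial (scale a g) (scale a h) (0# ∷ mulL as g) (0# ∷ mulL as h) ⟩
    addL (mulL (a ∷ as) g) (mulL (a ∷ as) h) ∎

  mulL-distribʳ : ∀ f g h → mulL (addL g h) f ≋ addL (mulL g f) (mulL h f)
  mulL-distribʳ f g h = begin
    mulL (addL g h) f           ≈⟨ mulL-comm (addL g h) f ⟩
    mulL f (addL g h)           ≈⟨ mulL-distribˡ f g h ⟩
    addL (mulL f g) (mulL f h)  ≈⟨ addL-cong (mulL-comm f g) (mulL-comm f h) ⟩
    addL (mulL g f) (mulL h f)  ∎

  mulL-scaleʳ : ∀ a f g → mulL f (scale a g) ≋ scale a (mulL f g)
  mulL-scaleʳ a []       g = refl
  mulL-scaleʳ a (b ∷ bs) g = begin
    addL (scale b (scale a g)) (0# ∷ mulL bs (scale a g))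
      ≈⟨ addL-cong (scale-comm b a g) (∷-cong (A.sym (A.zeroʳ a)) (mulL-scaleʳ a bs g)) ⟩
    addL (scale a (scale b g)) (scale a (0# ∷ mulL bs g))
      ≈⟨ scale-addL a (scale b g) (0# ∷ mulL bs g) ⟨
    scale a (mulL (b ∷ bs) g) ∎

  mulL-scaleˡ : ∀ a f g → mulL (scale a f) g ≋ scale a (mulL f g)
  mulL-scaleˡ a f g = begin
    mulL (scale a f) g ≈⟨ mulL-comm (scale a f) g ⟩
    mulL g (scale a f) ≈⟨ mulL-scaleʳ a g f ⟩
    scale a (mulL g f) ≈⟨ scale-cong A.refl (mulL-comm g f) ⟩
    scale a (mulL f g) ∎

  mulL-0∷ˡ : ∀ f g → mulL (0# ∷ f) g ≋ (0# ∷ mulL f g)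
  mulL-0∷ˡ f g = addL-congʳ (0# ∷ mulL f g) (scale-zeroˡ g)

  mulL-assoc : ∀ f g h → mulL (mulL f g) h ≋ mulL f (mulL g h)
  mulL-assoc []       g h = refl
  mulL-assoc (a ∷ as) g h = begin
    mulL (addL (scale a g) (0# ∷ mulL as g)) h
      ≈⟨ mulL-distribʳ h (scale a g) (0# ∷ mulL as g) ⟩
    addL (mulL (scale a g) h) (mulL (0# ∷ mulL as g) h)
      ≈⟨ addL-cong (mulL-scaleˡ a g h) (mulL-0∷ˡ (mulL as g) h) ⟩
    addL (scale a (mulL g h)) (0# ∷ mulL (mulL as g) h)
      ≈⟨ addL-congˡ (scale a (mulL g h)) (∷-cong A.refl (mulL-assoc as g h)) ⟩
    mulL (a ∷ as) (mulL g h) ∎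

  mulL-constˡ : ∀ a f → mulL (a ∷ []) f ≋ scale a f
  mulL-constˡ a f = trans (addL-congˡ (scale a f) 0∷[]≋[]) (addL-identityʳ (scale a f))

  mulL-identityˡ : ∀ f → mulL (1# ∷ []) f ≋ f
  mulL-identityˡ f = trans (mulL-constˡ 1# f) (scale-identityˡ f)

  listRing-isPolyRing : IsPolyRing listRing
  listRing-isPolyRing = record
    { isRing = record
      { +-isAbelianGroup = record
        { isGroup = record
          { isMonoid = record
            { isSemigroup = record
              { isMagma = record
                { isEquivalence = record
                  { refl  = λ {f} → to (refl {f})
                  ; sym   = λ {f} {g} p → to (sym (from {f} {g} p))
                  ; trans = λ {f} {g} {h} p q → to (trans (from {f} {g} p) (from {g} {h} q))
                  }
                ; ∙-cong = λ {f} {f′} {g} {g′} p q → to (addL-cong (from {f} {f′} p) (from {g} {g′} q))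
                }
              ; assoc = λ f g h → to (addL-assoc f g h)
              }
            ; identity = (λ f → to (refl {f})) , λ f → to (addL-identityʳ f)
            }
          ; inverse = (λ f → to (trans (addL-comm (negL f) f) (negL-inverseʳ f)))
                    , λ f → to (negL-inverseʳ f)
          ; ⁻¹-cong = λ {f} {g} p → to (negL-cong (from {f} {g} p))
          }
        ; comm = λ f g → to (addL-comm f g)
        }
      ; *-cong = λ {f} {f′} {g} {g′} p q → to (mulL-cong (from {f} {f′} p) (from {g} {g′} q))
      ; *-assoc = λ f g h → to (mulL-assoc f g h)
      ; *-identity = (λ f → to (mulL-identityˡ f))
                   , λ f → to (trans (mulL-comm f (1# ∷ [])) (mulL-identityˡ f))
      ; distrib = (λ f g h → to (mulL-distribˡ f g h)) , λ f g h → to (mulL-distribʳ f g h)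
      }
    ; *-comm = λ f g → to (mulL-comm f g)
    }

  polyRing : CommutativeRing c ℓ
  polyRing = toCommutativeRing listRing listRing-isPolyRing

  const : Carrier → List Carrier
  const a = a ∷ []

  open RingMorphisms (CommutativeRing.rawRing (toCommutativeRing A isPolyRing)) (CommutativeRing.rawRing polyRing)
    using (IsRingHomomorphism)

  const-isRingHomomorphism : IsRingHomomorphism const
  const-isRingHomomorphism = record
    { isSemiringHomomorphism = record
      { isNearSemiringHomomorphism = record
        { +-isMonoidHomomorphism = record
          { isMagmaHomomorphism = record
            { isRelHomomorphism = record { cong = λ a≈b → a≈b , tt }
            ; homo = λ a b → A.refl , tt
            }
          ; ε-homo = A.refl , tt
          }
        ; *-homo = λ a b → A.sym (A.+-identityʳ _) , tt
        }
      ; 1#-homo = A.refl , tt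
      }
    ; -‿homo = λ a → A.refl , tt
    }

  -- Annihilators of polynomials and McCoy's theorem.

  scale≋[]⇒All : ∀ a f → scale a f ≋ [] → All (λ b → a A.* b ≈ 0#) f
  scale≋[]⇒All a []       eq = []
  scale≋[]⇒All a (b ∷ bs) eq = at eq 0 ∷ scale≋[]⇒All a bs (mk (at eq ∘ suc))

  All⇒scale≋[] : ∀ a f → All (λ b → a A.* b ≈ 0#) f → scale a f ≋ []
  All⇒scale≋[] a []       []           = refl
  All⇒scale≋[] a (b ∷ bs) (ab≈0 ∷ eqs) = trans (∷-cong ab≈0 (All⇒scale≋[] a bs eqs)) 0∷[]≋[]

  ∷≋[]⇒≋[] : ∀ {a f} → (a ∷ f) ≋ [] → f ≋ []
  ∷≋[]⇒≋[] eq = mk (at eq ∘ suc)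

  -- McCoy's theorem for finite families. Let g kill F, with constant term b. For a coefficient a of a member
  -- of F one finds a b ≈ 0, so a g is X times a polynomial shorter than g that again kills F, whence a g ≈ 0;
  -- this exposes the next coefficient. So b is killed by all coefficients, b ≈ 0, and g itself gets shorter.
  private
    coefficientsKillConstant : ∀ {b bs} F →
      (∀ a → All (λ f → mulL (scale a bs) f ≋ []) F → scale a bs ≋ []) →
      All (λ f → mulL (b ∷ bs) f ≋ []) F →
      ∀ f → mulL (b ∷ bs) f ≋ [] → All (λ a → b A.* a ≈ 0#) f
    coefficientsKillConstant F ih gF≋0 [] _ = []
    coefficientsKillConstant {b} {bs} F ih gF≋0 (a ∷ as) gf≋0 =
      A.trans (A.*-comm b a) ab≈0
        ∷ coefficientsKillConstant F ih gF≋0 as (∷≋[]⇒≋[] (begin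
            0# ∷ mulL g as                       ≈⟨ addL-congʳ (0# ∷ mulL g as) ag≋0 ⟨
            addL (scale a g) (0# ∷ mulL g as)    ≈⟨ expand ⟩
            []                                   ∎))
      where
      g = b ∷ bs

      expand : addL (scale a g) (0# ∷ mulL g as) ≋ []
      expand = trans (sym (mulL-∷ʳ g a as)) gf≋0

      ab≈0 : a A.* b ≈ 0#
      ab≈0 = A.trans (A.sym (A.+-identityʳ _)) (at expand 0)

      step : ∀ {f} → mulL g f ≋ [] → mulL (scale a bs) f ≋ []
      step {f} eq = ∷≋[]⇒≋[] (begin
        0# ∷ mulL (scale a bs) f    ≈⟨ mulL-0∷ˡ (scale a bs) f ⟨
        mulL (0# ∷ scale a bs) f    ≈⟨ mulL-cong (∷-cong (A.sym ab≈0) (refl {scale a bs})) (refl {f}) ⟩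
        mulL (scale a g) f          ≈⟨ mulL-scaleˡ a g f ⟩
        scale a (mulL g f)          ≈⟨ scale-cong A.refl eq ⟩
        []                          ∎)

      ag≋0 : scale a g ≋ []
      ag≋0 = trans (∷-cong ab≈0 (ih a (All.map step gF≋0))) 0∷[]≋[]

    mcCoy-length : ∀ F → (∀ a → All (λ b → a A.* b ≈ 0#) (concat F) → a ≈ 0#) →
      ∀ m g → length g ≡ m → All (λ f → mulL g f ≋ []) F → g ≋ []
    mcCoy-length F ann m       []       _   _    = refl
    mcCoy-length F ann (suc m) (b ∷ bs) len gF≋0 = trans (∷-cong b≈0 bs≋0) 0∷[]≋[]
      where
      -- The length is the induction parameter because `scale a bs` is shorter than g but not a
      -- subterm of it.
      ih : ∀ g → length g ≡ m → All (λ f → mulL g f ≋ []) F → g ≋ []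
      ih = mcCoy-length F ann m

      b≈0 : b ≈ 0#
      b≈0 = ann b (concat⁺ (All.map (λ {f} → coefficientsKillConstant F
        (λ a → ih (scale a bs) (≡.trans (length-map (a A.*_) bs) (ℕ.suc-injective len))) gF≋0 f) gF≋0))

      bs≋0 : bs ≋ []
      bs≋0 = ih bs (ℕ.suc-injective len) (All.map (λ {f} eq → ∷≋[]⇒≋[] (begin
        0# ∷ mulL bs f    ≈⟨ mulL-0∷ˡ bs f ⟨
        mulL (0# ∷ bs) f  ≈⟨ mulL-cong (∷-cong (A.sym b≈0) (refl {bs})) (refl {f}) ⟩
        mulL (b ∷ bs) f   ≈⟨ eq ⟩
        []                ∎)) gF≋0)

  mcCoy : ∀ F → (∀ a → All (λ b → a A.* b ≈ 0#) (concat F) → a ≈ 0#) →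
    ∀ g → All (λ f → mulL g f ≈L []) F → g ≈L []
  mcCoy F ann g gF≈0 = to (mcCoy-length F ann (length g) g ≡.refl (All.map (λ eq → from eq) gF≈0))

  -- Powers of the variable, and regularity read off from one coefficient.

  X : List Carrier
  X = 0# ∷ 1# ∷ []

  mulL-X : ∀ f → mulL X f ≋ (0# ∷ f)
  mulL-X f = trans (mulL-0∷ˡ (1# ∷ []) f) (∷-cong A.refl (mulL-identityˡ f))

  open Exp (CommutativeRing.semiring polyRing) using (_^_)

  X^-cancel : ∀ k f → mulL (X ^ k) f ≋ [] → f ≋ []
  X^-cancel zero    f eq = trans (sym (mulL-identityˡ f)) eq
  X^-cancel (suc k) f eq = X^-cancel k f (∷≋[]⇒≋[] (begin
    0# ∷ mulL (X ^ k) f       ≈⟨ mulL-X (mulL (X ^ k) f) ⟨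
    mulL X (mulL (X ^ k) f)   ≈⟨ mulL-assoc X (X ^ k) f ⟨
    mulL (mulL X (X ^ k)) f   ≈⟨ eq ⟩
    []                        ∎))

  module _ (k : ℕ) where
    open DualNumbers (toCommutativeRing A isPolyRing) polyRing const-isRingHomomorphism X (X ^ k)
    private
      module AC = CommutativeRingProperties (toCommutativeRing A isPolyRing)
      module PC = CommutativeRingProperties polyRing

    -- Here Y = X^(k+1). Dropping the constant coefficient of a + Y (b + X q) and cancelling X^k
    -- leaves b + X q = 0, whose constant coefficient is b.
    lift-zero⇒zero : ∀ {a b} → Lift [] a b → b ≈ 0#
    lift-zero⇒zero {a} {b} (q , eq) = A.trans (A.sym (A.+-identityʳ b)) (at tail≋0 0)
      where
      G = addL (const b) (mulL X q)

      ZG≋0 : mulL (X ^ k) G ≋ []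
      ZG≋0 = ∷≋[]⇒≋[] {a A.+ 0#} (begin
        addL (const a) (0# ∷ mulL (X ^ k) G)       ≈⟨ addL-congˡ (const a) (mulL-X (mulL (X ^ k) G)) ⟨
        addL (const a) (mulL X (mulL (X ^ k) G))   ≈⟨ addL-congˡ (const a) (mulL-assoc X (X ^ k) G) ⟨
        addL (const a) (mulL (X ^ suc k) G)        ≈⟨ from eq ⟨
        []                                         ∎)

      tail≋0 : addL (const b) (0# ∷ q) ≋ []
      tail≋0 = trans (addL-congˡ (const b) (sym (mulL-X q))) (X^-cancel k G ZG≋0)

    -- By McCoy's theorem it suffices that every constant u with u f = 0 vanishes. The Y-part of u f
    -- is u b, so u b = 0, and b is regular.
    lift-regular : ∀ {f a b} → Lift f a b → AC.Regular b → PC.Regular f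
    lift-regular {f} {a} {b} L reg g gf≈0 = mcCoy (f ∷ []) ann g (gf≈0 ∷ [])
      where
      ann : ∀ u → All (λ c → u A.* c ≈ 0#) (concat (f ∷ [])) → u ≈ 0#
      ann u uf≈0 = reg u (A.trans (A.sym (A.trans (A.+-congˡ (A.zeroˡ a)) (A.+-identityʳ _)))
        (lift-zero⇒zero (proj₁ uL , CommutativeRing.trans polyRing (to {[]} {mulL (const u) f} (sym (begin
            mulL (const u) f ≈⟨ mulL-constˡ u f ⟩
            scale u f        ≈⟨ All⇒scale≋[] u f (≡.subst (All _) (++-identityʳ f) uf≈0) ⟩
            []               ∎))) (proj₂ uL))))
        where uL = lift-* (lift-const u) L

-- Polynomials in n variables.

module PolyProperties {c ℓ} (R : CommutativeRing c ℓ) where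
  private module R = CommutativeRing R
  open PolyDefs R

  isPolyRing : ∀ n → IsPolyRing (PolyRing n)
  isPolyRing zero    = R.isCommutativeRing
  isPolyRing (suc n) = ListPolyProperties.listRing-isPolyRing (PolyRing n) (isPolyRing n)

  polyRing : ∀ n → CommutativeRing c ℓ
  polyRing n = toCommutativeRing (PolyRing n) (isPolyRing n)

  constP-isRingHomomorphism : ∀ n →
    RingMorphisms.IsRingHomomorphism R.rawRing (CommutativeRing.rawRing (polyRing n)) (constP n)
  constP-isRingHomomorphism zero    = Identity.isRingHomomorphism R.rawRing R.refl
  constP-isRingHomomorphism (suc n) = Composition.isRingHomomorphism (CommutativeRing.trans (polyRing (suc n)))
    (constP-isRingHomomorphism n)
    (ListPolyProperties.const-isRingHomomorphism (PolyRing n) (isPolyRing n))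

  constP-injective : ∀ n r → RawPolyRing._≈_ (PolyRing n) (constP n r) (RawPolyRing.0# (PolyRing n)) → r R.≈ R.0#
  constP-injective zero    r r≈0       = r≈0
  constP-injective (suc n) r (r≈0 , _) = constP-injective n r r≈0

  -- McCoy's theorem one variable at a time: the coefficients of a family with respect to the first
  -- variable form the family for the others. Even a single polynomial has several coefficients,
  -- whence families.
  mcCoyP : ∀ n → let open RawPolyRing (PolyRing n) in (F : List (Poly n)) →
    (∀ r → All (λ f → (constP n r * f) ≈ 0#) F → r R.≈ R.0#) →
    ∀ g → All (λ f → (g * f) ≈ 0#) F → g ≈ 0#
  mcCoyP zero    F ann g gF≈0 = ann g gF≈0
  mcCoyP (suc n) F ann        = mcCoy F (mcCoyP n (concat F) λ r rF≈0 → ann r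
    (All.map (λ {f} rf≈0 → to (trans (mulL-constˡ (constP n r) f) (All⇒scale≋[] (constP n r) f rf≈0)))
      (concat⁻ {xss = F} rF≈0)))
    where
    open ListPolyProperties (PolyRing n) (isPolyRing n)
    open IsEquivalence ≋-isEquivalence using (trans)

  -- Power sums of the variables

  powerSumX : (n k : ℕ) → Poly n
  powerSumX n = CommutativeRingProperties.powerSumOf (polyRing n) (vars n)

  module _ (n : ℕ) where
    open CommutativeRing (polyRing n) hiding (zero)
    open Exp semiring using (_^_)
    open CommutativeRingProperties (polyRing n) using (powerSumOf)

    powP≡^ : ∀ f k → powP n f k ≡ f ^ k
    powP≡^ f zero    = ≡.refl
    powP≡^ f (suc k) = ≡.cong (f *_) (powP≡^ f k)

    powerSum≡powerSumX : ∀ k → powerSum n k ≡ powerSumX n k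
    powerSum≡powerSumX k = ≡.cong (foldr _+_ 0#) (map-cong (λ f → powP≡^ f k) (vars n))

    open ListPolyProperties (PolyRing n) (isPolyRing n) using (const; X)

    vars-suc : vars (suc n) ≡ X ∷ map const (vars n)
    vars-suc = ≡.cong (X ∷_) (≡.trans (map-tabulate suc (var (suc n)))
      (≡.sym (≡.trans (≡.cong (map const) (map-tabulate id (var n))) (map-tabulate (var n) const))))

    private
      module S = CommutativeRing (polyRing (suc n))
      module S^ = Exp S.semiring

    const-^ : ∀ f k → const f S^.^ k S.≈ const (f ^ k)
    const-^ f zero    = S.refl {S.1#}
    const-^ f (suc k) = S.trans {const f S.* (const f S^.^ k)} {const f S.* const (f ^ k)} {const (f ^ suc k)}
      (S.*-congˡ {const f} {const f S^.^ k} {const (f ^ k)} (const-^ f k)) (+-identityʳ _ , tt)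

    powerSumOf-const : ∀ fs k →
      CommutativeRingProperties.powerSumOf (polyRing (suc n)) (map const fs) k S.≈ const (powerSumOf fs k)
    powerSumOf-const []       k = refl , tt
    powerSumOf-const (f ∷ fs) k = S.+-cong
      {const f S^.^ k} {const (f ^ k)} {_} {const (powerSumOf fs k)}
      (const-^ f k) (powerSumOf-const fs k)

    powerSumX-suc : ∀ k → powerSumX (suc n) k S.≈ (X S^.^ k) S.+ const (powerSumX n k)
    powerSumX-suc k = S.trans {powerSumX (suc n) k} {_} {(X S^.^ k) S.+ const (powerSumX n k)}
      (S.reflexive (≡.cong (λ fs → CommutativeRingProperties.powerSumOf (polyRing (suc n)) fs k) vars-suc))
      (S.+-congˡ {X S^.^ k} {_} {const (powerSumX n k)} (powerSumOf-const (vars n) k))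

  -- Modulo Xˢ⁺², where X is the first of the n variables, only the corner entry of a Hankel matrix of power
  -- sums starting with p_{s+1} involves X, so the coefficient of Xˢ⁺¹ in its last pivot is its corner cofactor,
  -- a product of pivots of a smaller Hankel matrix in one variable less.
  hankel-regularPivots : ∀ N n s (H : CommutativeRingProperties.Matrix (polyRing n)) → N ≤ n →
    (∀ i j → RawPolyRing._≈_ (PolyRing n) (H i j) (powerSumX n (suc (s ℕ.+ (i ℕ.+ j))))) →
    CommutativeRingProperties.RegularPivots (polyRing n) N H
  hankel-regularPivots zero    n       s H N≤n       H≈ = tt
  -- The bound N ≤ n provides a variable X for every nonempty matrix.
  hankel-regularPivots (suc N) (suc m) s H (s≤s N≤m) H≈ =
    S.regularPivots-suc N H last-regular
      (hankel-regularPivots N (suc m) (suc (suc s)) (S.lower H) (ℕ.m≤n⇒m≤1+n N≤m) λ i j →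
        SR.trans {H (suc i) (suc j)} {_} {powerSumX (suc m) (suc (suc (suc s) ℕ.+ (i ℕ.+ j)))}
          (H≈ (suc i) (suc j)) (SR.reflexive (≡.cong (powerSumX (suc m) ∘ suc) (shift i j))))
    where
    module S = CommutativeRingProperties (polyRing (suc m))
    module SR = CommutativeRing (polyRing (suc m))
    module A = CommutativeRing (polyRing m)
    module AP = CommutativeRingProperties (polyRing m)
    open ListPolyProperties (PolyRing m) (isPolyRing m) using (X; const; const-isRingHomomorphism; lift-regular)
    open Exp SR.semiring using (_^_; ^-homo-*)
    -- Now Y = X^(s+1) is the X-part of the corner entry p_{s+1}. Every other entry is some p_l with
    -- l ≥ s + 2, and X^l is a multiple of Y X.
    open DualNumbers (polyRing m) (polyRing (suc m)) const-isRingHomomorphism X (X ^ s)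

    shift : ∀ i j → s ℕ.+ (suc i ℕ.+ suc j) ≡ suc (suc s) ℕ.+ (i ℕ.+ j)
    shift i j = ≡.trans (≡.cong (s ℕ.+_) (≡.cong suc (ℕ.+-suc i j)))
      (≡.trans (ℕ.+-suc s _) (≡.cong suc (ℕ.+-suc s _)))

    h : AP.Matrix
    h i j = powerSumX m (suc (s ℕ.+ (i ℕ.+ j)))

    lift-via : ∀ {f g a b} → f SR.≈ g → Lift g a b → Lift f a b
    lift-via {f} {g} {a} {b} f≈g (q , eq) =
      q , SR.trans {f} {g} {const a SR.+ Y SR.* (const b SR.+ X SR.* q)} f≈g eq

    lift-powerSum : ∀ k → Lift (powerSumX (suc m) (suc (s ℕ.+ suc k))) (powerSumX m (suc (s ℕ.+ suc k))) A.0#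
    lift-powerSum k = lift-via {powerSumX (suc m) l} {(Y SR.* (X SR.* (X ^ k))) SR.+ const (powerSumX m l)}
      (SR.trans {powerSumX (suc m) l} {(X ^ l) SR.+ const (powerSumX m l)}
                {(Y SR.* (X SR.* (X ^ k))) SR.+ const (powerSumX m l)}
        (powerSumX-suc m l)
        (SR.+-congʳ {const (powerSumX m l)} {X ^ l} {Y SR.* (X SR.* (X ^ k))} (^-homo-* X (suc s) (suc k))))
      (lift-resp {(Y SR.* (X SR.* (X ^ k))) SR.+ const (powerSumX m l)} (A.+-identityˡ _) (A.+-identityˡ _)
        (lift-+ {Y SR.* (X SR.* (X ^ k))} {const (powerSumX m l)} (lift-YX (X ^ k)) (lift-const (powerSumX m l))))
      where l = suc (s ℕ.+ suc k)

    lift-corner : Lift (H 0 0) (h 0 0) A.1#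
    lift-corner = lift-via {H 0 0} {Y SR.+ const (powerSumX m l)}
      (SR.trans {H 0 0} {powerSumX (suc m) l} {Y SR.+ const (powerSumX m l)} (H≈ 0 0)
        (SR.trans {powerSumX (suc m) l} {(X ^ l) SR.+ const (powerSumX m l)} {Y SR.+ const (powerSumX m l)}
          (powerSumX-suc m l)
          (SR.reflexive (≡.cong (λ k → (X ^ suc k) SR.+ const (powerSumX m l)) (ℕ.+-identityʳ s)))))
      (lift-resp {Y SR.+ const (powerSumX m l)} (A.+-identityˡ _) (A.+-identityʳ _)
        (lift-+ {Y} {const (powerSumX m l)} lift-Y (lift-const (powerSumX m l))))
      where l = suc (s ℕ.+ 0)

    lift-entry : ∀ i j {k} → i ℕ.+ j ≡ suc k → Lift (H i j) (h i j) A.0#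
    lift-entry i j {k} eq = lift-via {H i j} (H≈ i j)
      (≡.subst (λ l → Lift (powerSumX (suc m) (suc (s ℕ.+ l))) (powerSumX m (suc (s ℕ.+ l))) A.0#)
        (≡.sym eq) (lift-powerSum k))

    last-regular : S.Regular (S.lastPivot N H)
    last-regular = lift-regular s
      (lift-lastPivot N {H} {h}
        (λ i j → lift-entry i (suc j) (ℕ.+-suc i j)) (λ i j → lift-entry (suc i) j ≡.refl) lift-corner)
      -- The cofactor is built from the pivots of `lower h`, a Hankel matrix of size N ≤ m in m
      -- variables that starts two indices later, with p_{s+3}.
      (AP.regular-* AP.regular-1 (AP.cornerCofactor-regular N h
        (hankel-regularPivots N m (suc (suc s)) (AP.lower h) N≤m λ i j →
          A.reflexive (≡.cong (powerSumX m ∘ suc) (shift i j)))))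

module Fractions {c ℓ} (R : CommutativeRing c ℓ) (n : ℕ) where
  private module R = CommutativeRing R
  open PolyDefs R
  open PolyProperties R
  open CommutativeRing (polyRing n) hiding (zero)
  open CommutativeRingProperties (polyRing n)
  open Exp semiring using (_^_)
  open Mult semiring using () renaming (_×_ to _⋆_)
  open Solver commutativeSemiring using (solve; _:+_; _:*_; _:=_)
  open RingProperties ring using (-1*x≈-x; -‿distribʳ-*; -‿involutive)
  open SetoidReasoning setoid
  open RingMorphisms R.rawRing rawRing using (module IsRingHomomorphism)
  open IsRingHomomorphism (constP-isRingHomomorphism n) using (1#-homo; 0#-homo; +-homo; *-homo; ⟦⟧-cong)

  -- Elementary symmetric polynomials

  elemSymOf : List Carrier → ℕ → Carrier
  elemSymOf xs k = sumP n (map (prodP n) (combinations k xs))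

  sumP-++ : ∀ fs gs → sumP n (fs ++ gs) ≈ sumP n fs + sumP n gs
  sumP-++ []       gs = sym (+-identityˡ _)
  sumP-++ (f ∷ fs) gs = trans (+-congˡ (sumP-++ fs gs)) (sym (+-assoc f _ _))

  sumP-prodP-∷ : ∀ x css → sumP n (map (prodP n) (map (x ∷_) css)) ≈ x * sumP n (map (prodP n) css)
  sumP-prodP-∷ x []         = sym (zeroʳ x)
  sumP-prodP-∷ x (cs ∷ css) = trans (+-congˡ (sumP-prodP-∷ x css)) (sym (distribˡ x _ _))

  elemSymOf-∷ : ∀ x xs k → elemSymOf (x ∷ xs) (suc k) ≈ x * elemSymOf xs k + elemSymOf xs (suc k)
  elemSymOf-∷ x xs k = begin
    sumP n (map (prodP n) (map (x ∷_) (combinations k xs) ++ combinations (suc k) xs))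
      ≡⟨ ≡.cong (sumP n) (map-++ (prodP n) (map (x ∷_) (combinations k xs)) _) ⟩
    sumP n (map (prodP n) (map (x ∷_) (combinations k xs)) ++ map (prodP n) (combinations (suc k) xs))
      ≈⟨ sumP-++ (map (prodP n) (map (x ∷_) (combinations k xs))) _ ⟩
    sumP n (map (prodP n) (map (x ∷_) (combinations k xs))) + elemSymOf xs (suc k)
      ≈⟨ +-congʳ (sumP-prodP-∷ x (combinations k xs)) ⟩
    x * elemSymOf xs k + elemSymOf xs (suc k) ∎

  sign : ℕ → Carrier
  sign k = (- 1#) ^ k

  -- Up to signs, `elemSymOf-∷` is the recursion that defines `χ`.
  χ-elemSymOf : ∀ xs k → χ xs k ≈ sign k * elemSymOf xs k
  χ-elemSymOf xs       zero    = sym (trans (*-identityˡ _) (+-identityʳ _))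
  χ-elemSymOf []       (suc k) = sym (zeroʳ _)
  χ-elemSymOf (x ∷ xs) (suc k) = begin
    χ xs (suc k) + - x * χ xs k
      ≈⟨ +-cong (χ-elemSymOf xs (suc k)) (*-cong (sym (-1*x≈-x x)) (χ-elemSymOf xs k)) ⟩
    (- 1# * sign k) * elemSymOf xs (suc k) + (- 1# * x) * (sign k * elemSymOf xs k)
      ≈⟨ solve 5 (λ m s x a b → (m :* s) :* a :+ (m :* x) :* (s :* b) := (m :* s) :* (x :* b :+ a))
                 refl (- 1#) (sign k) x _ _ ⟩
    sign (suc k) * (x * elemSymOf xs k + elemSymOf xs (suc k)) ≈⟨ *-congˡ (elemSymOf-∷ x xs k) ⟨
    sign (suc k) * elemSymOf (x ∷ xs) (suc k) ∎

  sign²≈1 : ∀ k → sign k * sign k ≈ 1#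
  sign²≈1 zero    = *-identityˡ 1#
  sign²≈1 (suc k) = begin
    (- 1# * sign k) * (- 1# * sign k)
      ≈⟨ solve 2 (λ m s → (m :* s) :* (m :* s) := (m :* m) :* (s :* s)) refl (- 1#) (sign k) ⟩
    (- 1# * - 1#) * (sign k * sign k) ≈⟨ *-cong (trans (-1*x≈-x (- 1#)) (-‿involutive 1#)) (sign²≈1 k) ⟩
    1# * 1# ≈⟨ *-identityˡ 1# ⟩
    1# ∎

  elemSymOf-χ : ∀ xs k → elemSymOf xs k ≈ sign k * χ xs k
  elemSymOf-χ xs k = begin
    elemSymOf xs k                       ≈⟨ *-identityˡ _ ⟨
    1# * elemSymOf xs k                  ≈⟨ *-congʳ (sign²≈1 k) ⟨
    (sign k * sign k) * elemSymOf xs k   ≈⟨ *-assoc _ _ _ ⟩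
    sign k * (sign k * elemSymOf xs k)   ≈⟨ *-congˡ (χ-elemSymOf xs k) ⟨
    sign k * χ xs k                      ∎

  -- The degree of ∏ (1 - x T) is at most the number of factors.
  χ-vanishes : ∀ xs k → length xs < k → χ xs k ≈ 0#
  χ-vanishes []       (suc k) _           = refl
  χ-vanishes (x ∷ xs) (suc k) (s≤s xs<k) = begin
    χ xs (suc k) + - x * χ xs k
      ≈⟨ +-cong (χ-vanishes xs (suc k) (ℕ.m<n⇒m<1+n xs<k)) (trans (*-congˡ (χ-vanishes xs k xs<k)) (zeroʳ _)) ⟩
    0# + 0# ≈⟨ +-identityˡ 0# ⟩
    0#      ∎

  e± : ℕ → Carrier
  e± = χ (vars n)

  length-vars : length (vars n) ≡ n
  length-vars = ≡.trans (length-map (var n) (allFin n)) (length-tabulate id)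

  e±-vanishes : ∀ k → n < k → e± k ≈ 0#
  e±-vanishes k n<k = χ-vanishes (vars n) k (≡.subst (_< k) (≡.sym length-vars) n<k)

  newton-e± : ∀ k → (k ⋆ 1#) * e± k + Σ< k (λ t → powerSumX n (suc t) * e± (k ∸ suc t)) ≈ 0#
  newton-e± = newton (vars n)

  -- Regular elements of subrings

  -- By McCoy's theorem regularity need only be tested against constants from R, and these belong to
  -- the subring, where s is a non-zero-divisor.
  nonZeroDivSub⇒regular : ∀ {m} {g : Fin m → Carrier} {s} → NonZeroDivSub n g s → Regular s
  nonZeroDivSub⇒regular {s = s} (_ , nzd) a as≈0 = mcCoyP n (s ∷ [])
    (λ { r (rs≈0 ∷ []) → constP-injective n r (nzd (constP n r) (cst r , refl) rs≈0) }) a (as≈0 ∷ [])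

  inSub-isSubring : ∀ {m} (g : Fin m → Carrier) → IsSubring (InSub n g)
  inSub-isSubring g = record
    { resp  = λ { x≈y (E , eq) → E , trans eq x≈y }
    ; P-1   = cst R.1# , 1#-homo
    ; P-+   = λ { (E , eq) (F , eq′) → add E F , +-cong eq eq′ }
    ; P-*   = λ { (E , eq) (F , eq′) → mul E F , *-cong eq eq′ }
    ; P-neg = λ { (E , eq) → neg E , -‿cong eq }
    }

  inSub-minimal : ∀ {p} {P : Carrier → Set p} → IsSubring P → (∀ r → P (constP n r)) →
    ∀ {m} {g : Fin m → Carrier} → (∀ i → P (g i)) → ∀ {f} → InSub n g f → P f
  inSub-minimal {P = P} isSubring P-const {g = g} Pg (E , eq) = resp eq (P-eval E)
    where
    open IsSubring isSubring
    P-eval : ∀ E → P (eval n g E)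
    P-eval (cst r)   = P-const r
    P-eval (gen i)   = Pg i
    P-eval (add E F) = P-+ (P-eval E) (P-eval F)
    P-eval (mul E F) = P-* (P-eval E) (P-eval F)
    P-eval (neg E)   = P-neg (P-eval E)

  -- Fractions over a generated subring.

  module _ {m} (g : Fin m → Carrier) where
    private module B = IsSubring (inSub-isSubring g)

    -- The polynomials that lie in R(g). The generators on both sides of the theorem are
    -- polynomials, so the comparison can be made without forming a total ring of fractions.
    IsFraction : Carrier → Set (c ⊔ ℓ)
    IsFraction z = ∃ λ t → InSub n g t × Regular t × InSub n g (t * z)

    inSub⇒fraction : ∀ {z} → InSub n g z → IsFraction z
    inSub⇒fraction z∈ = 1# , B.P-1 , regular-1 , B.P-* B.P-1 z∈

    fraction-isDivisionClosed : IsDivisionClosed IsFraction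
    fraction-isDivisionClosed = record
      { isSubring = record
        { resp  = λ { x≈y (t , t∈ , rt , tx∈) → t , t∈ , rt , B.resp (*-congˡ x≈y) tx∈ }
        ; P-1   = inSub⇒fraction B.P-1
        ; P-+   = λ { {x} {y} (t , t∈ , rt , tx∈) (s , s∈ , rs , sy∈) → s * t , B.P-* s∈ t∈ , regular-* rs rt ,
            B.resp (solve 4 (λ s t x y → s :* (t :* x) :+ t :* (s :* y) := (s :* t) :* (x :+ y)) refl s t x y)
              (B.P-+ (B.P-* s∈ tx∈) (B.P-* t∈ sy∈)) }
        ; P-*   = λ { {x} {y} (t , t∈ , rt , tx∈) (s , s∈ , rs , sy∈) → t * s , B.P-* t∈ s∈ , regular-* rt rs ,
            B.resp (solve 4 (λ s t x y → (t :* x) :* (s :* y) := (t :* s) :* (x :* y)) refl s t x y)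
              (B.P-* tx∈ sy∈) }
        ; P-neg = λ { {x} (t , t∈ , rt , tx∈) → t , t∈ , rt , B.resp (-‿distribʳ-* t x) (B.P-neg tx∈) }
        }
      -- The numerator t x of x becomes part of the denominator, which is legitimate because x is
      -- regular: y = t (s x y) / (t x s).
      ; P-÷ = λ { {x} {y} (t , t∈ , rt , tx∈) rx (s , s∈ , rs , sxy∈) →
          (t * x) * s , B.P-* tx∈ s∈ , regular-* (regular-* rt rx) rs ,
          B.resp (solve 4 (λ s t x y → t :* (s :* (x :* y)) := ((t :* x) :* s) :* y) refl s t x y)
            (B.P-* t∈ sxy∈) }
      }

    fracSub : ∀ {m′} (f : Fin m′ → Carrier) → (∀ i → IsFraction (f i)) → FracSub n f g
    fracSub f f-frac a s a∈ s-nzd@(s∈ , _) with fraction a∈ | fraction s∈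
      where
      fraction : ∀ {z} → InSub n f z → IsFraction z
      fraction = inSub-minimal (IsDivisionClosed.isSubring fraction-isDivisionClosed)
        (λ r → inSub⇒fraction (cst r , refl)) f-frac
    ... | t , t∈ , rt , ta∈ | t′ , t′∈ , rt′ , t′s∈ =
      -- The fraction a/s is expanded by t t′, which brings numerator and denominator into the
      -- subring generated by g.
      t′ * (t * a) , t * (t′ * s) , B.P-* t′∈ ta∈ ,
      (B.P-* t∈ t′s∈ , λ b _ → regular-* rt (regular-* rt′ (nonZeroDivSub⇒regular s-nzd)) b) ,
      solve 4 (λ a s t t′ → a :* (t :* (t′ :* s)) := (t′ :* (t :* a)) :* s) refl a s t t′

  -- The sum in Newton's identity of index k + 1 ends with p_{k+1} times `e± 0`, which is 1, and
  -- otherwise involves earlier power sums only. The bound l in `below` carries the strong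
  -- induction.
  powerSumX∈elementary : ∀ k → InSub n (eGens n) (powerSumX n (suc k))
  powerSumX∈elementary k = below (suc k) k (ℕ.n<1+n k)
    where
    open IsSubring (inSub-isSubring (eGens n))

    e±∈ : ∀ k → InSub n (eGens n) (e± k)
    e±∈ zero    = P-1
    e±∈ (suc k) with k ℕ.<? n
    ... | yes k<n = resp (sym (χ-elemSymOf (vars n) (suc k)))
      (P-* (P-^ (P-neg P-1) (suc k))
           (gen (fromℕ< k<n) , reflexive (≡.cong (elemSym n ∘ suc) (toℕ-fromℕ< k<n))))
    ... | no k≮n  = resp (sym (e±-vanishes (suc k) (s≤s (ℕ.≮⇒≥ k≮n)))) P-0

    below : ∀ l k → k < l → InSub n (eGens n) (powerSumX n (suc k))
    below (suc l) k (s≤s k≤l) = resp last≈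
      (P-cancelˡ (P-Σ< k (λ t → powerSumX n (suc t) * e± (suc k ∸ suc t))
                   λ t t<k → P-* (below l t (ℕ.<-≤-trans t<k k≤l)) (e±∈ (k ∸ t)))
        (resp (Σ<-last k _) (P-cancelˡ (P-* (P-⋆1 (suc k)) (e±∈ (suc k)))
          (resp (sym (newton-e± (suc k))) P-0))))
      where
      last≈ : powerSumX n (suc k) * e± (k ∸ k) ≈ powerSumX n (suc k)
      last≈ = trans (*-congˡ (reflexive (≡.cong e± (ℕ.n∸n≡0 k)))) (*-identityʳ _)

  natR≈⋆1 : ∀ k → constP n (natR k) ≈ k ⋆ 1#
  natR≈⋆1 zero    = 0#-homo
  natR≈⋆1 (suc k) = trans (+-homo R.1# (natR k)) (+-cong 1#-homo (natR≈⋆1 k))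

  -- Elementary symmetric polynomials as fractions of power sums.

  module PowerSumFractions (r d : ℕ) (n≡ : n ≡ r ℕ.+ d) (0<r : 0 < r)
    (invertible : ∀ k → 1 ≤ k → k < r → Invertible (natR k)) where

    M : ℕ
    M = 2 ℕ.* n ℕ.+ 1 ∸ r

    open IsDivisionClosed (fraction-isDivisionClosed (pGens n M))

    Frac : Carrier → Set (c ⊔ ℓ)
    Frac = IsFraction (pGens n M)

    -- With n = r + d the number of generators 2n + 1 - r equals r + 2d + 1.
    index< : ∀ k → k ≤ r ℕ.+ d ℕ.+ d → k < M
    index< k k≤ = ℕ.m+n≤o⇒m≤o∸n (suc k) (ℕ.≤-trans (ℕ.+-monoˡ-≤ r (s≤s k≤)) (ℕ.≤-reflexive
      (≡.trans (solveℕ 2 (λ r d → con 1 ⊕ (r ⊕ d ⊕ d) ⊕ r ⊜ con 2 ⊗ (r ⊕ d) ⊕ con 1) ≡.refl r d)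
               (≡.cong (λ n → 2 ℕ.* n ℕ.+ 1) (≡.sym n≡)))))
      where
      open +-*-Solver using (con) renaming (solve to solveℕ; _:+_ to _⊕_; _:*_ to _⊗_; _:=_ to _⊜_)

    powerSumX-frac : ∀ k → k ≤ r ℕ.+ d ℕ.+ d → Frac (powerSumX n (suc k))
    powerSumX-frac k k≤ = inSub⇒fraction (pGens n M) (gen (fromℕ< (index< k k≤)) , reflexive
      (≡.trans (≡.cong (powerSum n ∘ suc) (toℕ-fromℕ< (index< k k≤))) (powerSum≡powerSumX n (suc k))))

    -- Newton's identity of index k + 1 < r can be solved for `e± (suc k)`, as the integer k + 1 has
    -- an inverse in R. The bound K carries the strong induction.
    e±-frac-small : ∀ K → K ≤ r → ∀ k → k < K → Frac (e± k)
    e±-frac-small (suc K) K<r zero    _         = P-1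
    e±-frac-small (suc K) K<r (suc k) (s≤s k<K) with invertible (suc k) (s≤s z≤n) (ℕ.≤-trans (s≤s k<K) K<r)
    ... | b , kb≈1 = resp cancel (P-* (inSub⇒fraction (pGens n M) (cst b , refl))
      (P-cancelʳ (P-Σ< (suc k) (λ t → powerSumX n (suc t) * e± (suc k ∸ suc t)) λ { t (s≤s t≤k) → P-*
          (powerSumX-frac t (ℕ.≤-trans t≤k (ℕ.≤-trans (ℕ.<⇒≤ k<K) (ℕ.≤-trans (ℕ.<⇒≤ K<r)
            (ℕ.≤-trans (ℕ.m≤m+n r d) (ℕ.m≤m+n (r ℕ.+ d) d))))))
          (e±-frac-small K (ℕ.<⇒≤ K<r) (k ∸ t) (ℕ.≤-<-trans (ℕ.m∸n≤m k t) k<K)) })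
        (resp (sym (newton-e± (suc k))) P-0)))
      where
      cancel : constP n b * ((suc k ⋆ 1#) * e± (suc k)) ≈ e± (suc k)
      cancel = begin
        constP n b * ((suc k ⋆ 1#) * e± (suc k)) ≈⟨ *-assoc _ _ _ ⟨
        (constP n b * (suc k ⋆ 1#)) * e± (suc k) ≈⟨ *-congʳ (*-congˡ (natR≈⋆1 (suc k))) ⟨
        (constP n b * constP n (natR (suc k))) * e± (suc k) ≈⟨ *-congʳ (*-comm _ _) ⟩
        (constP n (natR (suc k)) * constP n b) * e± (suc k) ≈⟨ *-congʳ (*-homo _ _) ⟨
        constP n (natR (suc k) R.* b) * e± (suc k) ≈⟨ *-congʳ (⟦⟧-cong kb≈1) ⟩
        constP n R.1# * e± (suc k) ≈⟨ *-congʳ 1#-homo ⟩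
        1# * e± (suc k) ≈⟨ *-identityˡ _ ⟩
        e± (suc k) ∎

    e±-frac-<r : ∀ k → k < r → Frac (e± k)
    e±-frac-<r = e±-frac-small r ℕ.≤-refl

    H : Matrix
    H i j = powerSumX n (suc (i ℕ.+ j))

    -- Newton's identity of index n + 1 + i involves only e_{n-j} with j ≤ n, and e_{n-j} is known for j > d.
    row-frac : ∀ i → i < suc d → Frac (Σ< (suc d) (λ j → H i j * e± (n ∸ j)))
    row-frac i (s≤s i≤d) = P-cancelʳ
      (P-Σ< r (λ j → H i (suc d ℕ.+ j) * e± (n ∸ (suc d ℕ.+ j))) λ j j<r → P-*
        (powerSumX-frac (i ℕ.+ (suc d ℕ.+ j)) (bound j j<r))
        (e±-frac-<r _ (ℕ.m<n+o⇒m∸n<o n (suc d ℕ.+ j) {{ℕ.>-nonZero 0<r}} (n<d+j+r j))))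
      (resp (sym row≈0) P-0)
      where
      m = i ℕ.+ suc n

      term : ℕ → Carrier
      term t = powerSumX n (suc t) * e± (m ∸ suc t)

      -- Equality holds for i = d and j = r - 1, where the power sum is the last generator
      -- p_{r+2d+1}; this is what fixes M.
      bound : ∀ j → j < r → i ℕ.+ (suc d ℕ.+ j) ≤ r ℕ.+ d ℕ.+ d
      bound j j<r = ℕ.≤-trans (ℕ.+-mono-≤ i≤d (ℕ.≤-trans (ℕ.≤-reflexive (≡.sym (ℕ.+-suc d j))) (ℕ.+-monoʳ-≤ d j<r)))
        (ℕ.≤-reflexive (≡.trans (≡.cong (d ℕ.+_) (ℕ.+-comm d r)) (ℕ.+-comm d (r ℕ.+ d))))

      n<d+j+r : ∀ j → n < suc d ℕ.+ j ℕ.+ r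
      n<d+j+r j = s≤s (ℕ.≤-trans (ℕ.≤-reflexive (≡.trans n≡ (ℕ.+-comm r d))) (ℕ.+-monoˡ-≤ r (ℕ.m≤m+n d j)))

      n<m : n < m
      n<m = ℕ.m≤n+m (suc n) i

      term-first : ∀ t → t < i → term t ≈ 0#
      term-first t t<i = trans (*-congˡ (e±-vanishes (m ∸ suc t) (ℕ.m+n≤o⇒m≤o∸n (suc n)
        (ℕ.≤-trans (ℕ.≤-reflexive (ℕ.+-comm (suc n) (suc t))) (ℕ.+-monoˡ-≤ (suc n) t<i))))) (zeroʳ _)

      term-later : ∀ j → term (i ℕ.+ j) ≈ H i j * e± (n ∸ j)
      term-later j = *-congˡ (reflexive (≡.cong e±
        (≡.trans (≡.cong (m ∸_) (≡.sym (ℕ.+-suc i j))) (ℕ.[m+n]∸[m+o]≡n∸o i (suc n) (suc j)))))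

      1+n≡ : suc n ≡ suc d ℕ.+ r
      1+n≡ = ≡.cong suc (≡.trans n≡ (ℕ.+-comm r d))

      -- In the identity of index m = n + 1 + i the leading term and the first i summands contain
      -- `e±` at an index above n and vanish. The other n + 1 = (d + 1) + r summands are split after
      -- j = d.
      row≈0 : Σ< (suc d) (λ j → H i j * e± (n ∸ j))
                + Σ< r (λ j → H i (suc d ℕ.+ j) * e± (n ∸ (suc d ℕ.+ j))) ≈ 0#
      row≈0 = begin
        _ ≈⟨ Σ<-split (suc d) r (λ j → H i j * e± (n ∸ j)) ⟨
        Σ< (suc d ℕ.+ r) (λ j → H i j * e± (n ∸ j)) ≡⟨ ≡.cong (λ k → Σ< k (λ j → H i j * e± (n ∸ j))) 1+n≡ ⟨
        Σ< (suc n) (λ j → H i j * e± (n ∸ j)) ≈⟨ Σ<-cong (suc n) (λ j _ → term-later j) ⟨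
        Σ< (suc n) (term ∘ (i ℕ.+_))
          ≈⟨ trans (+-congʳ (trans (Σ<-cong i term-first) (Σ<-zero i))) (+-identityˡ _) ⟨
        Σ< i term + Σ< (suc n) (term ∘ (i ℕ.+_)) ≈⟨ Σ<-split i (suc n) term ⟨
        Σ< m term ≈⟨ trans (+-congʳ (trans (*-congˡ (e±-vanishes m n<m)) (zeroʳ _))) (+-identityˡ _) ⟨
        (m ⋆ 1#) * e± m + Σ< m term ≈⟨ newton-e± m ⟩
        0# ∎

    -- As r ≥ 1, the size d + 1 of the Hankel matrix stays within the number of variables, as
    -- `hankel-regularPivots` requires.
    1+d≤n : suc d ≤ n
    1+d≤n = ℕ.≤-trans (ℕ.+-monoˡ-≤ d 0<r) (ℕ.≤-reflexive (≡.sym n≡))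

    -- For j ≤ d the index n - j runs through r, ..., n, the range left open by `e±-frac-<r`. The
    -- matrix starts with p_1, so s = 0, and its entries reach p_{2d+1}.
    e±-frac-≥r : ∀ j → j < suc d → Frac (e± (n ∸ j))
    e±-frac-≥r = solve-linear (suc d) H (λ j → e± (n ∸ j))
      (hankel-regularPivots (suc d) n 0 H 1+d≤n λ i j → refl)
      (λ { i j (s≤s i≤d) (s≤s j≤d) → powerSumX-frac (i ℕ.+ j)
        (ℕ.+-mono-≤ (ℕ.≤-trans i≤d (ℕ.m≤n+m d r)) j≤d) })
      row-frac

    e±-frac : ∀ k → k ≤ n → Frac (e± k)
    e±-frac k k≤n with k ℕ.<? r
    ... | yes k<r = e±-frac-<r k k<r
    ... | no k≮r  = resp (reflexive (≡.cong e± (ℕ.m∸[m∸n]≡n k≤n))) (e±-frac-≥r (n ∸ k)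
      (ℕ.m<n+o⇒m∸n<o n k (≡.subst (_< k ℕ.+ suc d) (≡.sym n≡) (ℕ.≤-<-trans (ℕ.+-monoˡ-≤ d (ℕ.≮⇒≥ k≮r))
        (ℕ.+-monoʳ-< k (ℕ.n<1+n d))))))

    eGens-frac : ∀ i → Frac (eGens n i)
    eGens-frac i = resp (sym (elemSymOf-χ (vars n) (suc (toℕ i))))
      (P-* (P-^ (P-neg P-1) (suc (toℕ i))) (e±-frac (suc (toℕ i)) (toℕ<n i)))

    pGens-frac : ∀ i → IsFraction (eGens n) (pGens n M i)
    pGens-frac i = inSub⇒fraction (eGens n) (IsSubring.resp (inSub-isSubring (eGens n))
      (reflexive (≡.sym (powerSum≡powerSumX n (suc (toℕ i))))) (powerSumX∈elementary (toℕ i)))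

    sameFrac : SameFrac n (eGens n) (pGens n M)
    sameFrac = fracSub (pGens n M) (eGens n) eGens-frac , fracSub (eGens n) (pGens n M) pGens-frac

open import Data.Nat using (_+_; _*_)

theorem2p8 : ∀ {c ℓ} (R : CommutativeRing c ℓ) (r₀ n : ℕ) →
    1 ≤ r₀ →
    ¬ PolyDefs.Invertible R (PolyDefs.natR R r₀) →
    (∀ k → 1 ≤ k → k < r₀ → PolyDefs.Invertible R (PolyDefs.natR R k)) →
    r₀ ≤ n →
    PolyDefs.SameFrac R n (PolyDefs.eGens R n) (PolyDefs.pGens R n (2 * n + 1 ∸ r₀))
theorem2p8 R r₀ n 0<r₀ _ invertible r₀≤n =
  Fractions.PowerSumFractions.sameFrac R n r₀ (n ∸ r₀) (≡.sym (ℕ.m+[n∸m]≡n r₀≤n)) 0<r₀ invertible
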